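{- The cycle index of the $3$-group $S_8^{(3)}$ of the symmetric group $S_8$, i.e. of the action of $S_8$ on the $56$ three-element subsets of $\{1,\dots,8\}$, in the variables $a_1,a_2,\dots$, is \begin{align*} Z(S_8^{(3)}) = \frac{1}{8!} \big(& a_{1}^{56} + 28 a_{1}^{26} a_{2}^{15} + 210 a_{1}^{12} a_{2}^{22} + 112 a_{1}^{11} a_{3}^{15} + 420 a_{1}^{6} a_{2}^{25} \\ & + 1120 a_{1}^{5} a_{2}^{3} a_{3}^{7} a_{6}^{4} + 420 a_{1}^{4} a_{2}^{4} a_{4}^{11} + 1680 a_{1}^{3} a_{2}^{4} a_{3}^{3} a_{6}^{6} + 2520 a_{1}^{2} a_{2}^{5} a_{4}^{11} \\ & + 1120 a_{1}^{2} a_{3}^{18} + 1120 a_{1}^{2} a_{3}^{8} a_{6}^{5} + 4032 a_{1} a_{5}^{5} a_{10}^{3} + 3360 a_{1} a_{2} a_{3} a_{4}^{2} a_{6} a_{12}^{3} \\ & + 2688 a_{1} a_{5}^{2} a_{15}^{3} + 1344 a_{1} a_{5}^{11} + 105 a_{2}^{28} + 1260 a_{2}^{6} a_{4}^{11} + 3360 a_{2} a_{3}^{2} a_{6}^{8} \\ & + 3360 a_{2} a_{6}^{9} + 1260 a_{4}^{14} + 5760 a_{7}^{8} + 5040 a_{8}^{7}\big). \end{align*}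
   Context: For a permutation group $A$ on a finite set, and $\alpha\in A$, let $j_k(\alpha)$ be the number of cycles of length $k$ in the disjoint cycle decomposition of $\alpha$ (fixed points counted as cycles of length $1$). The cycle index of $A$ is the polynomial $Z(A)=\frac{1}{|A|}\sum_{\alpha\in A}\prod_{k} a_k^{j_k(\alpha)}$ in the variables $a_1,a_2,\dots$ with rational coefficients. For $1\le r\le p$, $S_p^{(r)}$ (the $r$-group of $S_p$) is the permutation group on the set of $r$-element subsets of $\{1,\dots,p\}$ formed by the permutations $\alpha'$ induced by $\alpha\in S_p$ via $\alpha'\{i_1,\dots,i_r\}=\{\alpha i_1,\dots,\alpha i_r\}$. -}

module Defs where

open import Level using (0ℓ)
open import Algebra.Bundles using (CommutativeRing)
import Algebra.Properties.CommutativeMonoid.Sum as CMSum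
import Algebra.Properties.Semiring.Exp as Exp
open import Data.Bool.Base using (if_then_else_)
open import Data.Fin.Base using (Fin; zero; suc; punchIn)
open import Data.Fin.Permutation as Perm using (Permutation′; _⟨$⟩ʳ_; _⟨$⟩ˡ_)
open import Data.Fin.Subset using (Subset; inside; outside; ∣_∣; _∈_)
open import Data.Empty using (⊥)
open import Data.Integer.Base using (+_)
open import Data.Irrelevant using ([_]) renaming (map to mapᴵ)
open import Data.List.Base as List
  using (List; []; _∷_; _++_; allFin; concatMap; deduplicate; filter; foldr; iterate; length; upTo)
import Data.List.Membership.Propositional as Mem
import Data.List.Membership.DecPropositional as DecMem
import Data.List.Membership.Propositional.Properties as Memₚ
import Data.List.Membership.Setoid as SetoidMem
import Data.List.Membership.Setoid.Properties as SetoidMemₚ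
open import Data.List.Relation.Unary.All as All using (All)
import Data.List.Relation.Unary.AllPairs as AllPairs
open import Data.List.Relation.Unary.Any as Any using (here; there)
open import Data.List.Relation.Unary.Unique.Propositional using (Unique)
import Data.List.Relation.Unary.Unique.Propositional.Properties as Uniqueₚ
import Data.List.Relation.Unary.Unique.Setoid as SetoidUnique
import Data.List.Relation.Unary.Unique.DecSetoid.Properties as DecUniqueₚ
open import Data.Nat.Base using (ℕ; suc; NonZero)
import Data.Nat.Properties as ℕₚ
open import Data.Product.Base using (_×_; _,_; ∃-syntax)
open import Data.Rational.Base as ℚ using (ℚ; 0ℚ; 1ℚ; _/_)
open import Data.Refinement using (Refinement-syntax; value; _,_)
import Data.Refinement.Properties as Refinementₚ
open import Data.Vec.Base as Vec using (lookup; tabulate)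
import Data.Vec.Properties as Vecₚ
import Data.Bool.Properties as Boolₚ
open import Function.Base using (_∘_)
open import Function.Bundles using (_↔_; Inverse; mk↔ₛ′)
open import Function.Construct.Composition using (_↔-∘_)
open import Function.Construct.Identity using (↔-id)
open import Function.Construct.Symmetry using (↔-sym)
open import Relation.Binary.Bundles using (DecSetoid)
open import Relation.Binary.Properties.Setoid using (respʳ-flip)
open import Relation.Binary.Structures using (IsEquivalence)
open import Relation.Binary.Definitions using (DecidableEquality)
open import Relation.Binary.PropositionalEquality
  using (_≡_; refl; sym; trans; cong; module ≡-Reasoning)
open import Relation.Nullary.Decidable using (map′; recompute)

------------------------------------------------------------------------
-- Polynomials with rational coefficients in the variables a 0, a 1, …

-- ℚ[a₀, a₁, …] as the free commutative ℚ-algebra on the variables: ring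
-- expressions modulo the commutative-ring axioms and the requirement that
-- const is a ring homomorphism.  The variable a 0 plays no role in cycle
-- indices.
module Polynomial where

  infixl 6 _+_
  infixl 7 _*_
  infix  8 -_
  infix  4 _≈_

  data Poly : Set where
    const   : ℚ → Poly
    a       : ℕ → Poly
    _+_ _*_ : Poly → Poly → Poly
    -_      : Poly → Poly

  data _≈_ : Poly → Poly → Set where
    ≈-refl  : ∀ {p} → p ≈ p
    ≈-sym   : ∀ {p q} → p ≈ q → q ≈ p
    ≈-trans : ∀ {p q r} → p ≈ q → q ≈ r → p ≈ r

    +-cong : ∀ {p p′ q q′} → p ≈ p′ → q ≈ q′ → p + q ≈ p′ + q′
    *-cong : ∀ {p p′ q q′} → p ≈ p′ → q ≈ q′ → p * q ≈ p′ * q′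
    -‿cong : ∀ {p p′} → p ≈ p′ → - p ≈ - p′

    +-assoc     : ∀ p q r → (p + q) + r ≈ p + (q + r)
    +-comm      : ∀ p q → p + q ≈ q + p
    +-identityˡ : ∀ p → const 0ℚ + p ≈ p
    -‿inverseˡ  : ∀ p → - p + p ≈ const 0ℚ
    *-assoc     : ∀ p q r → (p * q) * r ≈ p * (q * r)
    *-comm      : ∀ p q → p * q ≈ q * p
    *-identityˡ : ∀ p → const 1ℚ * p ≈ p
    distribʳ    : ∀ p q r → (q + r) * p ≈ q * p + r * p

    const-+ : ∀ c d → const c + const d ≈ const (c ℚ.+ d)
    const-* : ∀ c d → const c * const d ≈ const (c ℚ.* d)

  ℚ[a] : CommutativeRing 0ℓ 0ℓ
  ℚ[a] = record
    { Carrier = Poly ; _≈_ = _≈_ ; _+_ = _+_ ; _*_ = _*_ ; -_ = -_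
    ; 0# = const 0ℚ ; 1# = const 1ℚ
    ; isCommutativeRing = record
      { isRing = record
        { +-isAbelianGroup = record
          { isGroup = record
            { isMonoid = record
              { isSemigroup = record
                { isMagma = record { isEquivalence = isEquivalence ; ∙-cong = +-cong }
                ; assoc = +-assoc
                }
              ; identity = +-identityˡ , λ p → ≈-trans (+-comm p _) (+-identityˡ p)
              }
            ; inverse = -‿inverseˡ , λ p → ≈-trans (+-comm p _) (-‿inverseˡ p)
            ; ⁻¹-cong = -‿cong
            }
          ; comm = +-comm
          }
        ; *-cong = *-cong
        ; *-assoc = *-assoc
        ; *-identity = *-identityˡ , λ p → ≈-trans (*-comm p _) (*-identityˡ p)
        ; distrib =
            (λ p q r → ≈-trans (*-comm p _)
              (≈-trans (distribʳ p q r) (+-cong (*-comm q p) (*-comm r p))))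
            , distribʳ
        }
      ; *-comm = *-comm
      }
    }
    where
    isEquivalence : IsEquivalence _≈_
    isEquivalence = record { refl = ≈-refl ; sym = ≈-sym ; trans = ≈-trans }

  open Exp (CommutativeRing.semiring ℚ[a]) public using (_^_)

  # : ℕ → Poly
  # n = const (+ n / 1)

  ∑ ∏ : {A : Set} → List A → (A → Poly) → Poly
  ∑ xs f = foldr (λ x p → f x + p) (# 0) xs
  ∏ xs f = foldr (λ x p → f x * p) (# 1) xs

open Polynomial public
  using (Poly; const; a; _+_; _*_; _≈_; _^_; #; ∑; ∏; ℚ[a])

------------------------------------------------------------------------
-- Permutation groups on finite sets

record FiniteSet : Set₁ where
  infix 4 _≟_
  field
    Carrier  : Set
    _≟_      : DecidableEquality Carrier
    elements : List Carrier
    unique   : Unique elements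
    complete : ∀ x → x Mem.∈ elements

  degree : ℕ
  degree = length elements

module _ (X : FiniteSet) where
  open FiniteSet X

  Bijection : Set
  Bijection = Carrier ↔ Carrier

  permDecSetoid : DecSetoid 0ℓ 0ℓ
  permDecSetoid = record
    { Carrier = Bijection
    ; _≈_ = λ α β → ∀ x → Inverse.to α x ≡ Inverse.to β x
    ; isDecEquivalence = record
      { isEquivalence = record
        { refl = λ _ → refl
        ; sym = λ e x → sym (e x)
        ; trans = λ e f x → trans (e x) (f x)
        }
      ; _≟_ = λ α β → map′ (λ all x → All.lookup all (complete x)) (λ e → All.tabulate (λ {x} _ → e x))
                (All.all? (λ x → Inverse.to α x ≟ Inverse.to β x) elements)
      }
    }

  open DecSetoid permDecSetoid using () renaming (setoid to permSetoid)

  record PermutationGroup : Set where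
    open SetoidMem permSetoid using () renaming (_∈_ to _∈ᴳ_)
    field
      members   : List Bijection
      distinct  : SetoidUnique.Unique permSetoid members
      id-closed : ↔-id Carrier ∈ᴳ members
      ∘-closed  : ∀ {α β} → α ∈ᴳ members → β ∈ᴳ members → (α ↔-∘ β) ∈ᴳ members
      ⁻¹-closed : ∀ {α} → α ∈ᴳ members → ↔-sym α ∈ᴳ members

    order : ℕ
    order = length members

    order-nonZero : NonZero order
    order-nonZero with members | id-closed
    ... | _ ∷ _ | _ = _

------------------------------------------------------------------------
-- Cycles and the cycle index

  module _ (α : Bijection) where

    -- The cycle (x, α x, α² x, …) through x.  Every point of it already
    -- occurs among the first `degree` iterates.
    cycle : Carrier → List Carrier
    cycle x = deduplicate _≟_ (iterate (Inverse.to α) x degree)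

    -- The cycle of one point out of each class of the relation
    -- "y lies on the cycle through x".
    cycles : List (List Carrier)
    cycles = List.map cycle (deduplicate (λ x y → DecMem._∈?_ _≟_ y (cycle x)) elements)

    j : ℕ → ℕ
    j k = length (filter (λ c → length c ℕₚ.≟ k) cycles)

  -- No cycle is longer than the degree, so the product over all k ≥ 1 stops
  -- there.
  cycleIndex : PermutationGroup → Poly
  cycleIndex A = const (+ 1 / order) * ∑ members (λ α → ∏ (List.map suc (upTo degree)) (λ k → a k ^ j α k))
    where
    open PermutationGroup A
    instance _ = order-nonZero

------------------------------------------------------------------------
-- The r-element subsets of Fin p

-- Fin p stands for {1, …, p}.
RSubset : ℕ → ℕ → Set
RSubset p r = [ S ∈ Subset p ∣ ∣ S ∣ ≡ r ]

consᵢ : ∀ {p r} → RSubset p r → RSubset (suc p) (suc r)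
consᵢ (S , e) = (inside Vec.∷ S) , mapᴵ (cong suc) e

consₒ : ∀ {p r} → RSubset p r → RSubset (suc p) r
consₒ (S , e) = (outside Vec.∷ S) , e

value-injective : ∀ {p r} {S T : RSubset p r} → value S ≡ value T → S ≡ T
value-injective = Refinementₚ.value-injective

consᵢ-injective : ∀ {p r} {S T : RSubset p r} → consᵢ S ≡ consᵢ T → S ≡ T
consᵢ-injective e = value-injective (Vecₚ.∷-injectiveʳ (cong value e))

consₒ-injective : ∀ {p r} {S T : RSubset p r} → consₒ S ≡ consₒ T → S ≡ T
consₒ-injective e = value-injective (Vecₚ.∷-injectiveʳ (cong value e))

rSubsets : ∀ p r → List (RSubset p r)
rSubsets 0       0       = (Vec.[] , [ refl ]) ∷ []
rSubsets 0       (suc r) = []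
rSubsets (suc p) 0       = List.map consₒ (rSubsets p 0)
rSubsets (suc p) (suc r) = List.map consᵢ (rSubsets p r) ++ List.map consₒ (rSubsets p (suc r))

rSubsets-complete : ∀ p r (S : RSubset p r) → S Mem.∈ rSubsets p r
rSubsets-complete p r (S , [ e ]) = go p r S (recompute (∣ S ∣ ℕₚ.≟ r) e)
  where
  go : ∀ p r (S : Subset p) (e : ∣ S ∣ ≡ r) → (S , [ e ]) Mem.∈ rSubsets p r
  go 0       .0      Vec.[]              refl = here refl
  go (suc p) (suc r) (inside Vec.∷ S)  e =
    Memₚ.∈-++⁺ˡ (Memₚ.∈-map⁺ consᵢ (go p r S (ℕₚ.suc-injective e)))
  go (suc p) 0       (outside Vec.∷ S) e = Memₚ.∈-map⁺ consₒ (go p 0 S e)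
  go (suc p) (suc r) (outside Vec.∷ S) e =
    Memₚ.∈-++⁺ʳ (List.map consᵢ (rSubsets p r)) (Memₚ.∈-map⁺ consₒ (go p (suc r) S e))

rSubsets-unique : ∀ p r → Unique (rSubsets p r)
rSubsets-unique 0       0       = All.[] AllPairs.∷ AllPairs.[]
rSubsets-unique 0       (suc r) = AllPairs.[]
rSubsets-unique (suc p) 0       = Uniqueₚ.map⁺ consₒ-injective (rSubsets-unique p 0)
rSubsets-unique (suc p) (suc r) = Uniqueₚ.++⁺
  (Uniqueₚ.map⁺ consᵢ-injective (rSubsets-unique p r))
  (Uniqueₚ.map⁺ consₒ-injective (rSubsets-unique p (suc r)))
  λ { (x∈ , y∈) → disjoint (Memₚ.∈-map⁻ consᵢ x∈) (Memₚ.∈-map⁻ consₒ y∈) }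
  where
  disjoint : ∀ {x} → ∃[ S ] (S Mem.∈ rSubsets p r × x ≡ consᵢ S) →
             ∃[ T ] (T Mem.∈ rSubsets p (suc r) × x ≡ consₒ T) → ⊥
  disjoint (_ , _ , refl) (_ , _ , e) with Vecₚ.∷-injectiveˡ (cong value e)
  ... | ()

rSubsetsOf : ℕ → ℕ → FiniteSet
rSubsetsOf p r = record
  { Carrier  = RSubset p r
  ; _≟_      = Refinementₚ._≟_ (Vecₚ.≡-dec Boolₚ._≟_)
  ; elements = rSubsets p r
  ; unique   = rSubsets-unique p r
  ; complete = rSubsets-complete p r
  }

------------------------------------------------------------------------
-- The permutations of Fin p

permutations : ∀ p → List (Permutation′ p)
permutations 0       = Perm.id ∷ []
permutations (suc p) =
  concatMap (λ i → List.map (Perm.insert zero i) (permutations p)) (allFin (suc p))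

insert-cong : ∀ {p} (i : Fin (suc p)) {π ρ : Permutation′ p} → π Perm.≈ ρ →
              Perm.insert zero i π Perm.≈ Perm.insert zero i ρ
insert-cong i e zero    = refl
insert-cong i e (suc k) = cong (punchIn i) (e k)

permutations-complete : ∀ p (π : Permutation′ p) → ∃[ ρ ] (ρ Mem.∈ permutations p × π Perm.≈ ρ)
permutations-complete 0       π = Perm.id , here refl , λ ()
permutations-complete (suc p) π with permutations-complete p (Perm.remove zero π)
... | ρ , ρ∈ , e =
  Perm.insert zero i ρ
  , Memₚ.∈-concatMap⁺ _ (Any.map (λ { refl → Memₚ.∈-map⁺ (Perm.insert zero i) ρ∈ }) (Memₚ.∈-allFin i))
  , λ k → trans (sym (Perm.insert-remove zero π k)) (insert-cong i {Perm.remove zero π} {ρ} e k)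
  where i = π ⟨$⟩ʳ zero

------------------------------------------------------------------------
-- The r-group of the symmetric group

-- {i₁, …, iᵣ} ↦ {α i₁, …, α iᵣ}, see ∈-image⁺ and ∈-image⁻.
image : ∀ {p} → Permutation′ p → Subset p → Subset p
image α S = tabulate (λ i → lookup S (α ⟨$⟩ˡ i))

lookup-image : ∀ {p} (α : Permutation′ p) S i → lookup (image α S) i ≡ lookup S (α ⟨$⟩ˡ i)
lookup-image α S = Vecₚ.lookup∘tabulate _

∈-image⁺ : ∀ {p} (α : Permutation′ p) {S i} → i ∈ S → (α ⟨$⟩ʳ i) ∈ image α S
∈-image⁺ α {S} {i} i∈S = Vecₚ.lookup⇒[]= _ _
  (trans (lookup-image α S _) (trans (cong (lookup S) (Perm.inverseˡ α)) (Vecₚ.[]=⇒lookup i∈S)))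

∈-image⁻ : ∀ {p} (α : Permutation′ p) {S k} → k ∈ image α S → ∃[ i ] (i ∈ S × α ⟨$⟩ʳ i ≡ k)
∈-image⁻ α {S} {k} k∈ =
  α ⟨$⟩ˡ k
  , Vecₚ.lookup⇒[]= _ _ (trans (sym (lookup-image α S k)) (Vecₚ.[]=⇒lookup k∈))
  , Perm.inverseʳ α

open CMSum ℕₚ.+-0-commutativeMonoid using (sum; sum-permute; sum-cong-≗)

indicator : ∀ {p} → Subset p → Fin p → ℕ
indicator S i = if lookup S i then 1 else 0

∣∣≡sum : ∀ {p} (S : Subset p) → ∣ S ∣ ≡ sum (indicator S)
∣∣≡sum Vec.[]              = refl
∣∣≡sum (inside  Vec.∷ S) = cong suc (∣∣≡sum S)
∣∣≡sum (outside Vec.∷ S) = ∣∣≡sum S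

∣image∣ : ∀ {p} (α : Permutation′ p) S → ∣ image α S ∣ ≡ ∣ S ∣
∣image∣ α S = begin
  ∣ image α S ∣                        ≡⟨ ∣∣≡sum (image α S) ⟩
  sum (indicator (image α S))          ≡⟨ sum-cong-≗ (λ i → cong (if_then 1 else 0) (lookup-image α S i)) ⟩
  sum (indicator S ∘ (α ⟨$⟩ˡ_))        ≡⟨ sum-permute (indicator S) (Perm.flip α) ⟨
  sum (indicator S)                    ≡⟨ ∣∣≡sum S ⟨
  ∣ S ∣                                ∎
  where open ≡-Reasoning

subset-ext : ∀ {p} {S T : Subset p} → (∀ i → lookup S i ≡ lookup T i) → S ≡ T
subset-ext {S = S} {T} e =
  trans (sym (Vecₚ.tabulate∘lookup S)) (trans (Vecₚ.tabulate-cong e) (Vecₚ.tabulate∘lookup T))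

image-∘ : ∀ {p} (α β : Permutation′ p) S → image (α ↔-∘ β) S ≡ image α (image β S)
image-∘ α β S = subset-ext λ i →
  trans (lookup-image (α ↔-∘ β) S i)
    (sym (trans (lookup-image α (image β S) i) (lookup-image β S _)))

image-id : ∀ {p} (S : Subset p) → image Perm.id S ≡ S
image-id = Vecₚ.tabulate∘lookup

image-cong : ∀ {p} (α β : Permutation′ p) → α Perm.≈ β → ∀ S → image α S ≡ image β S
image-cong α β e S = Vecₚ.tabulate-cong λ i → cong (lookup S)
  (trans (sym (Perm.inverseˡ β))
    (cong (β ⟨$⟩ˡ_) (trans (sym (e (α ⟨$⟩ˡ i))) (Perm.inverseʳ α))))

image-inverse : ∀ {p} (α : Permutation′ p) S → image α (image (Perm.flip α) S) ≡ S
image-inverse α S = begin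
  image α (image (Perm.flip α) S)  ≡⟨ image-∘ α (Perm.flip α) S ⟨
  image (α ↔-∘ Perm.flip α) S      ≡⟨ image-cong (α ↔-∘ Perm.flip α) Perm.id (λ _ → Perm.inverseʳ α) S ⟩
  image Perm.id S                  ≡⟨ image-id S ⟩
  S                                ∎
  where open ≡-Reasoning

induced : ∀ {p} r → Permutation′ p → RSubset p r ↔ RSubset p r
induced {p} r α = mk↔ₛ′ (act α) (act (Perm.flip α))
  (λ S → Refinementₚ.value-injective (image-inverse α (value S)))
  (λ S → Refinementₚ.value-injective (image-inverse (Perm.flip α) (value S)))
  where
  act : Permutation′ p → RSubset p r → RSubset p r
  act α (S , e) = image α S , mapᴵ (trans (∣image∣ α S)) e

-- The distinct induced permutations: different α may induce the same one
-- (for r = p all of them do).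
rGroup : ∀ p r → PermutationGroup (rSubsetsOf p r)
rGroup p r = record
  { members   = members
  ; distinct  = DecUniqueₚ.deduplicate-! (permDecSetoid (rSubsetsOf p r)) inducedAll
  ; id-closed = ∈-intro (↔-id _) Perm.id λ S → Refinementₚ.value-injective (sym (image-id (value S)))
  ; ∘-closed  = λ {α} {β} → ∘-closed {α} {β}
  ; ⁻¹-closed = λ {α} → ⁻¹-closed {α}
  }
  where
  open DecSetoid (permDecSetoid (rSubsetsOf p r))
    using () renaming (setoid to permSetoid; _≟_ to _≟ᴾ_; _≈_ to _≈ᴾ_)
  open SetoidMem permSetoid using () renaming (_∈_ to _∈ᴳ_)

  inducedAll members : List (RSubset p r ↔ RSubset p r)
  inducedAll = List.map (induced r) (permutations p)
  members    = deduplicate _≟ᴾ_ inducedAll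

  ∈-intro : ∀ α (α₀ : Permutation′ p) → α ≈ᴾ induced r α₀ → α ∈ᴳ members
  ∈-intro α α₀ α≈ with permutations-complete p α₀
  ... | ρ , ρ∈ , α₀≈ρ =
    SetoidMemₚ.∈-deduplicate⁺ permSetoid _≟ᴾ_
      (λ {β} {γ} {δ} → respʳ-flip permSetoid {β} {γ} {δ}) {xs = inducedAll} {z = α}
      (Any.map (λ { refl S → trans (α≈ S) (Refinementₚ.value-injective (image-cong α₀ ρ α₀≈ρ (value S))) })
        (Memₚ.∈-map⁺ (induced r) ρ∈))

  ∈-elim : ∀ α → α ∈ᴳ members → ∃[ α₀ ] α ≈ᴾ induced r α₀
  ∈-elim α α∈ = go (permutations p) (SetoidMemₚ.∈-deduplicate⁻ permSetoid _≟ᴾ_ inducedAll {z = α} α∈)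
    where
    go : ∀ xs → α ∈ᴳ List.map (induced r) xs → ∃[ α₀ ] α ≈ᴾ induced r α₀
    go (ρ ∷ xs) (here α≈)  = ρ , α≈
    go (ρ ∷ xs) (there α∈) = go xs α∈

  ∘-closed : ∀ {α β} → α ∈ᴳ members → β ∈ᴳ members → (α ↔-∘ β) ∈ᴳ members
  ∘-closed {α} {β} α∈ β∈ with ∈-elim α α∈ | ∈-elim β β∈
  ... | α₀ , α≈ | β₀ , β≈ = ∈-intro (α ↔-∘ β) (α₀ ↔-∘ β₀) λ S →
    trans (cong (Inverse.to α) (β≈ S)) (trans (α≈ (Inverse.to (induced r β₀) S))
      (Refinementₚ.value-injective (sym (image-∘ α₀ β₀ (value S)))))

  ⁻¹-closed : ∀ {α} → α ∈ᴳ members → ↔-sym α ∈ᴳ members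
  ⁻¹-closed {α} α∈ with ∈-elim α α∈
  ... | α₀ , α≈ = ∈-intro (↔-sym α) (Perm.flip α₀) λ S →
    let S′ = Inverse.from (induced r α₀) S in
    trans (cong (Inverse.from α) (trans (sym (Inverse.strictlyInverseˡ (induced r α₀) S)) (sym (α≈ S′))))
      (Inverse.strictlyInverseʳ α S′)

{-# OPTIONS --safe #-}

-- The number of k-cycles of an induced permutation is the number of subsets
-- that return to themselves after exactly k steps, divided by k; in particular
-- the cycle monomial of α is a class function F of α.  Sort the permutations of
-- {0, …, n} by the image of 0.  The sum of F over those fixing 0 runs over the
-- permutations of {1, …, n}; and for i ≠ 0, conjugating by a permutation that
-- fixes 0 and moves 1 to i shows that the permutations sending 0 to i and those
-- sending 0 to 1 contribute equally.  Hence
--   Σ F(π) = Σ F(1 ⊕ ρ) + n Σ F((0 1) (1 ⊕ ρ)),   ρ ∈ S_n,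
-- where both summands are again invariant under the conjugations fixing the
-- first point.  Iterating reduces the sum over S_8 to 128 explicit permutations
-- with multiplicities, whose cycle monomials are computed.
module Submission where

open import Defs
open import Data.Integer.Base using (+_)
open import Data.Nat.Base using (_!)
open import Data.Rational.Base using (_/_)

open import Algebra.Bundles using (CommutativeRing)
import Algebra.Properties.CommutativeMonoid.Mult as Mult
open import Data.Bool.Base using (if_then_else_; true; false)
import Data.Bool.Properties as Boolₚ
open import Data.Fin.Base using (Fin; zero; suc; toℕ; punchOut)
open import Data.Fin.Permutation as Perm
  using (Permutation′; _⟨$⟩ʳ_; _⟨$⟩ˡ_; lift₀; transpose; insert; remove)
import Data.Fin.Properties as Finₚ
open import Data.Fin.Subset as Subset using (Subset; inside; outside; ∣_∣)
import Data.Fin.Subset.Properties as Subsetₚ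
import Data.Integer.Base as ℤ
import Data.Integer.Properties as ℤₚ
open import Data.Irrelevant using ([_])
open import Data.List.Base as List
  using (List; []; _∷_; _++_; allFin; concat; concatMap; deduplicate; filter; foldl; foldr; length; map; tabulate; upTo)
import Data.List.Membership.DecPropositional as DecMem
open import Data.List.Membership.Propositional using (_∈_; find)
import Data.List.Membership.Propositional.Properties as Memₚ
import Data.List.Membership.Propositional.Properties.WithK as Memₖ
import Data.List.Membership.Setoid as SetoidMem
import Data.List.Membership.Setoid.Properties as SetoidMemₚ
import Data.List.Properties as Listₚ
open import Data.List.Relation.Binary.BagAndSetEquality using (∼bag⇒↭)
open import Data.List.Relation.Binary.Disjoint.Propositional using (Disjoint)
import Data.List.Relation.Binary.Permutation.Propositional as ↭
import Data.List.Relation.Binary.Permutation.Propositional.Properties as ↭ₚ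
import Data.List.Relation.Binary.Permutation.Setoid as Setoid↭
import Data.List.Relation.Binary.Permutation.Setoid.Properties as Setoid↭ₚ
open import Data.List.Relation.Unary.All as All using (All; []; _∷_)
import Data.List.Relation.Unary.All.Properties as Allₚ
open import Data.List.Relation.Unary.AllPairs as AllPairs using (AllPairs; []; _∷_)
import Data.List.Relation.Unary.AllPairs.Properties as AllPairsₚ
open import Data.List.Relation.Unary.Any as Any using (here; there)
import Data.List.Relation.Unary.Any.Properties as Anyₚ
import Data.List.Relation.Unary.Unique.DecPropositional.Properties as DecUniqueₚ
import Data.List.Relation.Unary.Unique.DecSetoid.Properties as DecSetoidUniqueₚ
open import Data.List.Relation.Unary.Unique.Propositional using (Unique)
import Data.List.Relation.Unary.Unique.Propositional.Properties as Uniqueₚ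
import Data.List.Relation.Unary.Unique.Setoid as SetoidUnique
import Data.List.Relation.Unary.Unique.Setoid.Properties as SetoidUniqueₚ
open import Data.Nat.Base as ℕ using (ℕ; zero; suc; _≤_; _<_; z≤n; s≤s; NonZero)
import Data.Nat.Coprimality as Coprimality
open import Data.Nat.DivMod using (_%_; m≡m%n+[m/n]*n; m%n<n; m*n/n≡m)
open import Data.Nat.GeneralisedArithmetic using (iterate)
import Data.Nat.Properties as ℕₚ
open import Data.Product.Base using (_×_; _,_; ∃; ∃-syntax; map₂)
import Data.Product.Properties as ×ₚ
open import Data.Rational.Base as ℚ using (mkℚ)
import Data.Rational.Properties as ℚₚ
open import Data.Refinement using (value; _,_)
open import Data.Vec.Base as Vec using (Vec; _∷_; lookup)
import Data.Vec.Properties as Vecₚ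
open import Function.Base using (_∘_)
open import Function.Bundles using (Inverse; Injection; mk⇔)
open import Function.Construct.Composition using (_↔-∘_)
open import Function.Properties.Inverse using (↔⇒↣)
open import Level using (0ℓ)
open import Relation.Binary.Bundles using (Setoid; DecSetoid)
import Relation.Binary.Construct.On as On
open import Relation.Binary.Core using (Rel)
open import Relation.Binary.Definitions using (Decidable; DecidableEquality)
open import Relation.Binary.Properties.Setoid using (respʳ-flip)
open import Relation.Binary.PropositionalEquality as ≡
  using (_≡_; _≢_; refl; sym; trans; cong; cong₂; subst; module ≡-Reasoning)
import Relation.Binary.Reasoning.Setoid as SetoidReasoning
open import Relation.Nullary using (¬_; Dec; yes; no; does; contradiction)
open import Relation.Nullary.Decidable using (decidable-stable; toWitness)

open CommutativeRing ℚ[a]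
  using ( +-commutativeMonoid; +-isCommutativeMonoid; +-assoc; +-comm; +-congˡ; +-congʳ; +-identityˡ; +-identityʳ
        ; *-assoc; *-congˡ; *-congʳ; *-identityˡ; *-identityʳ; distribʳ; zeroˡ )
  renaming ( setoid to polySetoid; refl to ≈-refl; sym to ≈-sym; trans to ≈-trans; reflexive to ≈-reflexive
           ; +-cong to ⊕-cong; *-cong to ⊗-cong )
open Mult +-commutativeMonoid using (×-assocˡ; ×-congʳ; ×-distrib-+; ×-homo-+) renaming (_×_ to _·_)
module ≈-Reasoning = SetoidReasoning polySetoid

private
  variable
    A B : Set

-- Iterates of a function

iterate-+ : ∀ (f : A → A) x m n → iterate f x (m ℕ.+ n) ≡ iterate f (iterate f x m) n
iterate-+ f x zero    n = refl
iterate-+ f x (suc m) n = iterate-+ f (f x) m n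

iterate-suc : ∀ (f : A → A) x n → iterate f (f x) n ≡ f (iterate f x n)
iterate-suc f x zero    = refl
iterate-suc f x (suc n) = iterate-suc f (f x) n

iterate-* : ∀ (f : A → A) {x} d → iterate f x d ≡ x → ∀ q → iterate f x (q ℕ.* d) ≡ x
iterate-* f     d e zero    = refl
iterate-* f {x} d e (suc q) = begin
  iterate f x (d ℕ.+ q ℕ.* d)              ≡⟨ iterate-+ f x d (q ℕ.* d) ⟩
  iterate f (iterate f x d) (q ℕ.* d)      ≡⟨ cong (λ y → iterate f y (q ℕ.* d)) e ⟩
  iterate f x (q ℕ.* d)                    ≡⟨ iterate-* f d e q ⟩
  x                                        ∎
  where open ≡-Reasoning

iterate-% : ∀ (f : A → A) {x} d .{{_ : NonZero d}} → iterate f x d ≡ x →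
            ∀ n → iterate f x n ≡ iterate f x (n % d)
iterate-% f {x} d e n = begin
  iterate f x n                                        ≡⟨ cong (iterate f x) (trans (m≡m%n+[m/n]*n n d) (ℕₚ.+-comm (n % d) _)) ⟩
  iterate f x (n ℕ./ d ℕ.* d ℕ.+ n % d)                ≡⟨ iterate-+ f x (n ℕ./ d ℕ.* d) (n % d) ⟩
  iterate f (iterate f x (n ℕ./ d ℕ.* d)) (n % d)      ≡⟨ cong (λ y → iterate f y (n % d)) (iterate-* f d e (n ℕ./ d)) ⟩
  iterate f x (n % d)                                  ∎
  where open ≡-Reasoning

∈-iterate⁺ : ∀ (f : A → A) x {i n} → i < n → iterate f x i ∈ List.iterate f x n
∈-iterate⁺ f x {zero}  (s≤s _)   = here refl
∈-iterate⁺ f x {suc i} (s≤s i<n) = there (∈-iterate⁺ f (f x) i<n)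

∈-iterate⁻ : ∀ (f : A → A) x n {y} → y ∈ List.iterate f x n → ∃[ i ] (i < n × y ≡ iterate f x i)
∈-iterate⁻ f x (suc n) (here e)   = 0 , s≤s z≤n , e
∈-iterate⁻ f x (suc n) (there y∈) with ∈-iterate⁻ f (f x) n y∈
... | i , i<n , e = suc i , s≤s i<n , e

module _ {f : A → A} (f-injective : ∀ {x y} → f x ≡ f y → x ≡ y) where

  iterate-injective : ∀ {x y} n → iterate f x n ≡ iterate f y n → x ≡ y
  iterate-injective zero    e = e
  iterate-injective (suc n) e = f-injective (iterate-injective n e)

  -- It suffices that `x` itself is not revisited: by injectivity, a repetition further along pulls
  -- back to a return to `x`.
  iterate-unique : ∀ {x} n → (∀ {m} → m < n → iterate f (f x) m ≢ x) → Unique (List.iterate f x (suc n))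
  iterate-unique     zero    ≢x = [] ∷ []
  iterate-unique {x} (suc n) ≢x =
    All.tabulate (λ y∈ x≡y → let i , i<n , e = ∈-iterate⁻ f (f x) (suc n) y∈ in
      ≢x i<n (trans (sym e) (sym x≡y)))
    ∷ iterate-unique n λ {m} m<n e →
        ≢x (ℕₚ.m<n⇒m<1+n m<n) (f-injective (trans (sym (iterate-suc f (f x) m)) e))

-- Counted from the predecessor of y: firstReturn f x n (f x) is the period of x,
-- provided that it is at most n.
firstReturn : DecidableEquality A → (A → A) → A → ℕ → A → ℕ
firstReturn _≟_ f x zero    y = 0
firstReturn _≟_ f x (suc n) y = if does (y ≟ x) then 1 else suc (firstReturn _≟_ f x n (f y))

module _ (_≟_ : DecidableEquality A) (f : A → A) (x : A) where

  -- A known return within the fuel `n` rules out the default value 0. The search stops at the first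
  -- hit, so all earlier iterates differ from `x`.
  firstReturn-minimal : ∀ n y {d} → d < n → iterate f y d ≡ x →
    ∃[ r ] (firstReturn _≟_ f x n y ≡ suc r × iterate f y r ≡ x × (∀ {m} → m < r → iterate f y m ≢ x))
  firstReturn-minimal (suc n) y d<n e with y ≟ x
  ... | yes y≡x = 0 , refl , y≡x , λ ()
  firstReturn-minimal (suc n) y {zero}  d<n       e | no y≢x = contradiction e y≢x
  firstReturn-minimal (suc n) y {suc d} (s≤s d<n) e | no y≢x with firstReturn-minimal n (f y) d<n e
  ... | r , r≡ , e′ , min = suc r , cong suc r≡ , e′ , λ { {zero} _ → y≢x ; {suc m} (s≤s m<r) → min m<r }

-- Serves two purposes below: with `h` a conjugating bijection it compares conjugate permutations,
-- and with `h = value` it passes from `RSubset` to bare subsets.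
firstReturn-map : (_≟_ : DecidableEquality A) (_≟′_ : DecidableEquality B) {f : A → A} {g : B → B} (h : A → B) →
  (∀ {x y} → h x ≡ h y → x ≡ y) → (∀ x → h (f x) ≡ g (h x)) →
  ∀ x n y → firstReturn _≟_ f x n y ≡ firstReturn _≟′_ g (h x) n (h y)
firstReturn-map _≟_ _≟′_ {f} {g} h h-injective h∘f x zero    y = refl
firstReturn-map _≟_ _≟′_ {f} {g} h h-injective h∘f x (suc n) y with y ≟ x | h y ≟′ h x
... | yes _   | yes _   = refl
... | yes y≡x | no  ≢   = contradiction (cong h y≡x) ≢
... | no  y≢x | yes e   = contradiction (h-injective e) y≢x
... | no  _   | no  _   = cong suc (trans (firstReturn-map _≟_ _≟′_ h h-injective h∘f x n (f y))
                            (cong (firstReturn _≟′_ g (h x) n) (h∘f y)))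

-- Cycles

unique∧set⇒↭ : {xs ys : List A} → Unique xs → Unique ys →
  (∀ {z} → z ∈ xs → z ∈ ys) → (∀ {z} → z ∈ ys → z ∈ xs) → xs ↭.↭ ys
unique∧set⇒↭ xs! ys! xs⊆ys ys⊆xs = ∼bag⇒↭ (Memₖ.unique∧set⇒bag xs! ys! (mk⇔ xs⊆ys ys⊆xs))

multiplicity : ℕ → List ℕ → ℕ
multiplicity k ns = length (filter (ℕₚ._≟ k) ns)

multiplicity-map : ∀ (f : A → ℕ) k xs → multiplicity k (map f xs) ≡ length (filter (λ x → f x ℕₚ.≟ k) xs)
multiplicity-map f k []       = refl
multiplicity-map f k (x ∷ xs) with does (f x ℕₚ.≟ k)
... | true  = cong suc (multiplicity-map f k xs)
... | false = multiplicity-map f k xs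

length-concat : ∀ {k} {xss : List (List A)} → All (λ xs → length xs ≡ k) xss →
                length (concat xss) ≡ length xss ℕ.* k
length-concat []                   = refl
length-concat {xss = xs ∷ xss} (e ∷ es) = trans (Listₚ.length-++ xs) (cong₂ ℕ._+_ e (length-concat es))

module _ (X : FiniteSet) (α : Bijection X) where
  open FiniteSet X
  private
    f = Inverse.to α

    f-injective : ∀ {x y} → f x ≡ f y → x ≡ y
    f-injective = Injection.injective (↔⇒↣ α)

  -- Among the `degree + 1` iterates from `x` to `iterate f x degree` two coincide, and injectivity
  -- cancels the smaller exponent. The number `d` is one less than the return time, since the
  -- iteration starts at `f x`.
  returns : ∀ x → ∃[ d ] (d < degree × iterate f (f x) d ≡ x)
  returns x with Finₚ.pigeonhole (ℕₚ.n<1+n degree) (λ i → Any.index (complete (iterate f x (toℕ i))))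
  ... | i , k , i<k , e with ℕₚ.m≤n⇒∃[o]m+o≡n i<k
  ... | d , i+d≡k = d
    , ℕₚ.≤-trans (ℕₚ.≤-trans (s≤s (ℕₚ.m≤n+m d (toℕ i))) (ℕₚ.≤-reflexive i+d≡k)) (ℕ.s≤s⁻¹ (Finₚ.toℕ<n k))
    , iterate-injective f-injective (toℕ i) (begin
        iterate f (iterate f x (suc d)) (toℕ i)   ≡⟨ iterate-+ f x (suc d) (toℕ i) ⟨
        iterate f x (suc d ℕ.+ toℕ i)             ≡⟨ cong (iterate f x ∘ suc) (ℕₚ.+-comm d (toℕ i)) ⟩
        iterate f x (suc (toℕ i ℕ.+ d))           ≡⟨ cong (iterate f x) i+d≡k ⟩
        iterate f x (toℕ k)                       ≡⟨ Anyₚ.lookup-index (complete (iterate f x (toℕ k))) ⟩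
        List.lookup elements _                    ≡⟨ cong (List.lookup elements) e ⟨
        List.lookup elements _                    ≡⟨ Anyₚ.lookup-index (complete (iterate f x (toℕ i))) ⟨
        iterate f x (toℕ i)                       ∎)
    where open ≡-Reasoning

  -- `cycle` keeps only the first `degree` iterates; reducing `n` modulo the return time `suc d`,
  -- which is at most `degree`, brings it into that range.
  ∈-cycle⁺ : ∀ x n → iterate f x n ∈ cycle X α x
  ∈-cycle⁺ x n = let d , d<degree , e = returns x in
    subst (_∈ cycle X α x) (sym (iterate-% f (suc d) e n))
      (Memₚ.∈-deduplicate⁺ _≟_ (∈-iterate⁺ f x (ℕₚ.<-≤-trans (m%n<n n (suc d)) d<degree)))

  ∈-cycle⁻ : ∀ {x y} → y ∈ cycle X α x → ∃[ n ] y ≡ iterate f x n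
  ∈-cycle⁻ {x} y∈ = let i , _ , e = ∈-iterate⁻ f x degree (Memₚ.∈-deduplicate⁻ _≟_ _ y∈) in i , e

  cycle-unique : ∀ x → Unique (cycle X α x)
  cycle-unique x = DecUniqueₚ.deduplicate-! _≟_ _

  -- This is the relation by which `cycles` selects representatives. Knowing that it is an
  -- equivalence gives access to the general facts about `deduplicate`.
  sameCycle : DecSetoid 0ℓ 0ℓ
  sameCycle = record
    { Carrier = Carrier
    ; _≈_ = λ x y → y ∈ cycle X α x
    ; isDecEquivalence = record
      { isEquivalence = record
        { refl  = λ {x} → ∈-cycle⁺ x 0
        ; sym   = λ {x} {y} → ∈-sym {x} {y}
        ; trans = λ {x} {y} {z} → ∈-trans {x} {y} {z}
        }
      ; _≟_ = λ x y → DecMem._∈?_ _≟_ y (cycle X α x)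
      }
    }
    where
    ∈-trans : ∀ {x y z} → y ∈ cycle X α x → z ∈ cycle X α y → z ∈ cycle X α x
    ∈-trans {x} y∈ z∈ with ∈-cycle⁻ y∈ | ∈-cycle⁻ z∈
    ... | m , refl | n , refl = subst (_∈ cycle X α x) (iterate-+ f x m n) (∈-cycle⁺ x (m ℕ.+ n))

    ∈-sym : ∀ {x y} → y ∈ cycle X α x → x ∈ cycle X α y
    ∈-sym {x} {y} y∈ with ∈-cycle⁻ y∈ | returns x
    ... | n , y≡ | d , _ , e =
      -- Continuing from `y` for the remainder of the period leads back to `x`.
      subst (_∈ cycle X α y) back (∈-cycle⁺ y (suc d ℕ.∸ n % suc d))
      where
      open ≡-Reasoning
      back : iterate f y (suc d ℕ.∸ n % suc d) ≡ x
      back = begin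
        iterate f y (suc d ℕ.∸ n % suc d)                            ≡⟨ cong (λ z → iterate f z (suc d ℕ.∸ n % suc d)) (trans y≡ (iterate-% f (suc d) e n)) ⟩
        iterate f (iterate f x (n % suc d)) (suc d ℕ.∸ n % suc d)    ≡⟨ iterate-+ f x (n % suc d) _ ⟨
        iterate f x (n % suc d ℕ.+ (suc d ℕ.∸ n % suc d))            ≡⟨ cong (iterate f x) (ℕₚ.m+[n∸m]≡n (ℕₚ.<⇒≤ (m%n<n n (suc d)))) ⟩
        iterate f (f x) d                                            ≡⟨ e ⟩
        x                                                            ∎

  private
    module ∼ = DecSetoid sameCycle

  cycleLengths : List ℕ
  cycleLengths = map (λ x → length (cycle X α x)) elements

  length-cycle-cong : ∀ {x y} → y ∈ cycle X α x → length (cycle X α y) ≡ length (cycle X α x)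
  length-cycle-cong {x} {y} y∈ = ↭ₚ.↭-length (unique∧set⇒↭ (cycle-unique y) (cycle-unique x)
    (λ {z} → ∼.trans {x} {y} {z} y∈) (λ {z} → ∼.trans {y} {x} {z} (∼.sym {x} {y} y∈)))

  -- The cycles of length k partition the points whose cycle has length k.
  j-* : ∀ k → j X α k ℕ.* k ≡ multiplicity k cycleLengths
  j-* k = begin
    length cs ℕ.* k                ≡⟨ length-concat (Allₚ.all-filter (λ c → length c ℕₚ.≟ k) (cycles X α)) ⟨
    length (concat cs)             ≡⟨ ↭ₚ.↭-length (unique∧set⇒↭ concat-unique (Uniqueₚ.filter⁺ P? unique) concat⊆ ⊆concat) ⟩
    length (filter P? elements)    ≡⟨ multiplicity-map _ k elements ⟨
    multiplicity k cycleLengths    ∎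
    where
    open ≡-Reasoning
    P? : ∀ x → Dec (length (cycle X α x) ≡ k)
    P? x = length (cycle X α x) ℕₚ.≟ k

    cs : List (List Carrier)
    cs = filter (λ c → length c ℕₚ.≟ k) (cycles X α)

    disjoint : ∀ {x y} → ¬ (y ∈ cycle X α x) → Disjoint (cycle X α x) (cycle X α y)
    disjoint {x} {y} y∉ {z} (z∈x , z∈y) = y∉ (∼.trans {x} {z} {y} z∈x (∼.sym {y} {z} z∈y))

    concat-unique : Unique (concat cs)
    concat-unique = Uniqueₚ.concat⁺
      (Allₚ.filter⁺ (λ c → length c ℕₚ.≟ k) (Allₚ.map⁺ (All.universal cycle-unique (deduplicate ∼._≟_ elements))))
      (AllPairsₚ.filter⁺ (λ c → length c ℕₚ.≟ k) (AllPairsₚ.map⁺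
        (AllPairs.map disjoint (DecSetoidUniqueₚ.deduplicate-! sameCycle elements))))

    concat⊆ : ∀ {z} → z ∈ concat cs → z ∈ filter P? elements
    concat⊆ {z} z∈ with Memₚ.∈-concat⁻′ cs z∈
    ... | c , z∈c , c∈cs with Memₚ.∈-filter⁻ (λ c → length c ℕₚ.≟ k) {xs = cycles X α} c∈cs
    ... | c∈ , |c|≡k with Memₚ.∈-map⁻ (cycle X α) c∈
    ... | x , _ , refl = Memₚ.∈-filter⁺ P? (complete z) (trans (length-cycle-cong z∈c) |c|≡k)

    ⊆concat : ∀ {z} → z ∈ filter P? elements → z ∈ concat cs
    ⊆concat {z} z∈ with Memₚ.∈-filter⁻ P? {xs = elements} z∈
    -- Deduplication keeps some representative `x` of the class of `z`, and the cycle through `x`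
    -- contains `z`.
    ... | z∈elements , |z|≡k with find (SetoidMemₚ.∈-deduplicate⁺ ∼.setoid ∼._≟_ (λ {u} {v} {w} → respʳ-flip ∼.setoid {u} {v} {w})
                                       {z = z} (Any.map (λ { refl → ∼.refl {z} }) z∈elements))
    ... | x , x∈ , x∈z = Memₚ.∈-concat⁺′ (∼.sym {z} {x} x∈z)
      (Memₚ.∈-filter⁺ (λ c → length c ℕₚ.≟ k) (Memₚ.∈-map⁺ (cycle X α) x∈) (trans (length-cycle-cong x∈z) |z|≡k))

  -- Both sides count the distinct iterates of `x`. The right-hand side avoids deduplication, is
  -- suited to evaluation and can be transported by `firstReturn-map`.
  length-cycle : ∀ x → length (cycle X α x) ≡ firstReturn _≟_ f x degree (f x)
  length-cycle x with returns x
  ... | d , d<degree , e with firstReturn-minimal _≟_ f x degree (f x) d<degree e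
  ... | r , r≡ , e′ , min = begin
    length (cycle X α x)                   ≡⟨ ↭ₚ.↭-length (unique∧set⇒↭ (cycle-unique x) (iterate-unique f-injective r min) cycle⊆ ⊆cycle) ⟩
    length (List.iterate f x (suc r))      ≡⟨ Listₚ.length-iterate f x (suc r) ⟩
    suc r                                  ≡⟨ r≡ ⟨
    firstReturn _≟_ f x degree (f x)       ∎
    where
    open ≡-Reasoning

    cycle⊆ : ∀ {z} → z ∈ cycle X α x → z ∈ List.iterate f x (suc r)
    cycle⊆ z∈ with ∈-cycle⁻ z∈
    ... | n , refl = subst (_∈ List.iterate f x (suc r)) (sym (iterate-% f (suc r) e′ n))
      (∈-iterate⁺ f x (m%n<n n (suc r)))

    ⊆cycle : ∀ {z} → z ∈ List.iterate f x (suc r) → z ∈ cycle X α x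
    ⊆cycle z∈ with ∈-iterate⁻ f x (suc r) z∈
    ... | i , _ , refl = ∈-cycle⁺ x i

-- Recovers the cycle counts from the list of cycle lengths of the points, in which no
-- representatives are chosen.
j-/ : ∀ X α k → j X α (suc k) ≡ multiplicity (suc k) (cycleLengths X α) ℕ./ suc k
j-/ X α k = trans (sym (m*n/n≡m (j X α (suc k)) (suc k))) (cong (ℕ._/ suc k) (j-* X α (suc k)))

-- Conjugation invariance of the cycle counts

module _ (X : FiniteSet) where
  open FiniteSet X

  -- The cycle of `α` through `x` is as long as the cycle of `β` through `γ x`. As `γ` rearranges
  -- the points, the two lists agree only up to order.
  cycleLengths-conj : ∀ (α β γ : Bijection X) →
    (∀ x → Inverse.to γ (Inverse.to α x) ≡ Inverse.to β (Inverse.to γ x)) →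
    cycleLengths X α ↭.↭ cycleLengths X β
  cycleLengths-conj α β γ γα≗βγ = begin
    map (λ x → length (cycle X α x)) elements                       ≡⟨ Listₚ.map-cong same elements ⟩
    map (λ x → length (cycle X β (Inverse.to γ x))) elements        ≡⟨ Listₚ.map-∘ elements ⟩
    map (λ x → length (cycle X β x)) (map (Inverse.to γ) elements)  ↭⟨ ↭ₚ.map⁺ _ (unique∧set⇒↭ (Uniqueₚ.map⁺ γ-injective unique) unique (λ _ → complete _)
                                                                          λ {z} _ → subst (_∈ map (Inverse.to γ) elements) (Inverse.strictlyInverseˡ γ z) (Memₚ.∈-map⁺ _ (complete _))) ⟩
    map (λ x → length (cycle X β x)) elements                       ∎
    where
    open ↭.PermutationReasoning

    γ-injective : ∀ {x y} → Inverse.to γ x ≡ Inverse.to γ y → x ≡ y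
    γ-injective = Injection.injective (↔⇒↣ γ)

    same : ∀ x → length (cycle X α x) ≡ length (cycle X β (Inverse.to γ x))
    same x = trans (length-cycle X α x)
      (trans (firstReturn-map _≟_ _≟_ (Inverse.to γ) γ-injective γα≗βγ x degree _)
        (trans (cong (firstReturn _≟_ (Inverse.to β) (Inverse.to γ x) degree) (γα≗βγ x))
          (sym (length-cycle X β (Inverse.to γ x)))))

  j-conj : ∀ (α β γ : Bijection X) →
    (∀ x → Inverse.to γ (Inverse.to α x) ≡ Inverse.to β (Inverse.to γ x)) →
    ∀ k → j X α (suc k) ≡ j X β (suc k)
  j-conj α β γ γα≗βγ k = trans (j-/ X α k) (trans
    (cong (ℕ._/ suc k) (↭ₚ.↭-length (↭ₚ.filter-↭ (ℕₚ._≟ suc k) (cycleLengths-conj α β γ γα≗βγ))))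
    (sym (j-/ X β k)))

-- Finite sums of polynomials

∑-map : ∀ (g : A → B) xs (F : B → Poly) → ∑ (map g xs) F ≡ ∑ xs (F ∘ g)
∑-map g xs F = Listₚ.foldr-map _ g (# 0) xs

∑-cong : ∀ (xs : List A) {F G : A → Poly} → (∀ x → F x ≈ G x) → ∑ xs F ≈ ∑ xs G
∑-cong []       e = ≈-refl
∑-cong (x ∷ xs) e = ⊕-cong (e x) (∑-cong xs e)

∑-++ : ∀ (xs ys : List A) F → ∑ (xs ++ ys) F ≈ ∑ xs F + ∑ ys F
∑-++ []       ys F = ≈-sym (+-identityˡ _)
∑-++ (x ∷ xs) ys F = ≈-trans (+-congˡ (∑-++ xs ys F)) (≈-sym (+-assoc _ _ _))

∑-concatMap : ∀ (g : A → List B) xs F → ∑ (concatMap g xs) F ≈ ∑ xs (λ x → ∑ (g x) F)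
∑-concatMap g []       F = ≈-refl
∑-concatMap g (x ∷ xs) F = ≈-trans (∑-++ (g x) (concatMap g xs) F) (+-congˡ (∑-concatMap g xs F))

∑-· : ∀ n (xs : List A) F → n · ∑ xs F ≈ ∑ xs (λ x → n · F x)
∑-· n []       F = n·0 n
  where
  n·0 : ∀ n → n · # 0 ≈ # 0
  n·0 zero    = ≈-refl
  n·0 (suc n) = ≈-trans (+-identityˡ _) (n·0 n)
∑-· n (x ∷ xs) F = ≈-trans (×-distrib-+ (F x) (∑ xs F) n) (+-congˡ (∑-· n xs F))

∑-const : ∀ (xs : List A) F p → All (λ x → F x ≈ p) xs → ∑ xs F ≈ length xs · p
∑-const []       F p []       = ≈-refl
∑-const (x ∷ xs) F p (e ∷ es) = ⊕-cong e (∑-const xs F p es)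

-- Enumerations without repetition of the same subset of a setoid

module _ (S : Setoid 0ℓ 0ℓ) where
  open Setoid S renaming (refl to ∼-refl; sym to ∼-sym; trans to ∼-trans; _≈_ to _∼_)
  open SetoidMem S using () renaming (_∈_ to _∈ˢ_)
  open SetoidUnique S using () renaming (Unique to Uniqueˢ)
  open Setoid↭ S using (_↭_; ↭-prep; ↭-trans; ↭-sym; ↭-refl)
  open Setoid↭ₚ S using (∈-resp-↭; Unique-resp-↭; shift)

  -- Permutations are compared pointwise, so a version for setoids is required. By induction on
  -- `xs`, the entry of `ys` matching the head is moved to the front, and uniqueness keeps the head
  -- out of both remainders.
  unique∧set⇒↭ˢ : ∀ {xs ys} → Uniqueˢ xs → Uniqueˢ ys →
    (∀ {z} → z ∈ˢ xs → z ∈ˢ ys) → (∀ {z} → z ∈ˢ ys → z ∈ˢ xs) → xs ↭ ys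
  unique∧set⇒↭ˢ {[]}     {[]}     _ _ _ _ = ↭-refl
  unique∧set⇒↭ˢ {[]}     {y ∷ ys} _ _ _ ys⊆[] with () ← ys⊆[] (here ∼-refl)
  unique∧set⇒↭ˢ {x ∷ xs} {ys} (x∉xs ∷ xs!) ys! xs⊆ys ys⊆xs
    with SetoidMemₚ.∈-∃++ S (xs⊆ys (here ∼-refl))
  ... | as , bs , w , x∼w , ys≋ = ↭-trans (↭-prep x (unique∧set⇒↭ˢ xs! rest! ⊆₁ ⊆₂)) (↭-sym ys↭)
    where
    ys↭ : ys ↭ x ∷ as ++ bs
    ys↭ = ↭-trans (Setoid↭.refl ys≋) (shift (∼-sym x∼w) as bs)

    x∷rest! : Uniqueˢ (x ∷ as ++ bs)
    x∷rest! = Unique-resp-↭ ys↭ ys!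

    rest! : Uniqueˢ (as ++ bs)
    rest! with x∷rest!
    ... | _ ∷ u = u

    x∉rest : All (λ z → ¬ (x ∼ z)) (as ++ bs)
    x∉rest with x∷rest!
    ... | x∉ ∷ _ = x∉

    drop : ∀ {zs us} → All (λ z → ¬ (x ∼ z)) zs → (∀ {z} → z ∈ˢ zs → z ∈ˢ (x ∷ us)) → ∀ {z} → z ∈ˢ zs → z ∈ˢ us
    drop x∉ ⊆x∷ z∈ with ⊆x∷ z∈
    ... | there z∈us = z∈us
    ... | here z∼x   = contradiction (∼-sym z∼x) (All.lookupₛ S (λ u∼v x≁u x∼v → x≁u (∼-trans x∼v (∼-sym u∼v))) x∉ z∈)

    ⊆₁ : ∀ {z} → z ∈ˢ xs → z ∈ˢ (as ++ bs)
    ⊆₁ = drop x∉xs (∈-resp-↭ ys↭ ∘ xs⊆ys ∘ there)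

    ⊆₂ : ∀ {z} → z ∈ˢ (as ++ bs) → z ∈ˢ xs
    ⊆₂ = drop x∉rest (ys⊆xs ∘ ∈-resp-↭ (↭-sym ys↭) ∘ there)

  ∑-set : ∀ {xs ys} → Uniqueˢ xs → Uniqueˢ ys →
    (∀ {z} → z ∈ˢ xs → z ∈ˢ ys) → (∀ {z} → z ∈ˢ ys → z ∈ˢ xs) →
    ∀ F → (∀ {x y} → x ∼ y → F x ≈ F y) → ∑ xs F ≈ ∑ ys F
  ∑-set {xs} {ys} xs! ys! xs⊆ys ys⊆xs F F-cong = begin
    ∑ xs F                        ≡⟨ ∑-map F xs (λ p → p) ⟨
    foldr _+_ (# 0) (map F xs)    ≈⟨ Setoid↭ₚ.foldr-commMonoid polySetoid +-isCommutativeMonoid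
                                       (Setoid↭ₚ.map⁺ S polySetoid F-cong (unique∧set⇒↭ˢ xs! ys! xs⊆ys ys⊆xs)) ⟩
    foldr _+_ (# 0) (map F ys)    ≡⟨ ∑-map F ys (λ p → p) ⟩
    ∑ ys F                        ∎
    where open ≈-Reasoning

-- Sums over the symmetric group

permSetoid : ℕ → Setoid 0ℓ 0ℓ
permSetoid n = On.setoid (Fin n ≡.→-setoid Fin n) (_⟨$⟩ʳ_ {n} {n})

perm-injective : ∀ {n} (π : Permutation′ n) {i k} → π ⟨$⟩ʳ i ≡ π ⟨$⟩ʳ k → i ≡ k
perm-injective π = Injection.injective (↔⇒↣ π)

insert-injective : ∀ {n} i {π ρ : Permutation′ n} → insert zero i π Perm.≈ insert zero i ρ → π Perm.≈ ρ
insert-injective i e k = Finₚ.punchIn-injective i _ _ (e (suc k))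

module _ {n : ℕ} where
  open SetoidUnique (permSetoid n) using () renaming (Unique to Uniqueᴾ) public
  open SetoidMem (permSetoid n) using () renaming (_∈_ to _∈ᴾ_) public

map-at-zero : ∀ {n i} (h : Permutation′ n → Permutation′ (suc n)) → (∀ ρ → h ρ ⟨$⟩ʳ zero ≡ i) →
              ∀ {π} ρs → π ∈ᴾ map h ρs → π ⟨$⟩ʳ zero ≡ i
map-at-zero h h0     (ρ ∷ _)  (here e)   = trans (e zero) (h0 ρ)
map-at-zero h h0 {π} (_ ∷ ρs) (there π∈) = map-at-zero h h0 {π} ρs π∈

-- Different blocks are told apart by the image of 0; within a block, insertion is injective.
permutations-unique : ∀ n → Uniqueᴾ (permutations n)
permutations-unique zero    = [] ∷ []
permutations-unique (suc n) = SetoidUniqueₚ.concat⁺ (permSetoid (suc n))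
  (Allₚ.map⁺ (All.universal (λ i → SetoidUniqueₚ.map⁺ (permSetoid n) (permSetoid (suc n))
    (λ {π} {ρ} → insert-injective i {π} {ρ}) (permutations-unique n)) (allFin (suc n))))
  (AllPairsₚ.map⁺ (AllPairsₚ.tabulate⁺ λ {i} {k} i≢k {π} → disjoint {i} {k} i≢k {π}))
  where
  disjoint : ∀ {i k} → i ≢ k → ∀ {π} → ¬ (π ∈ᴾ map (insert zero i) (permutations n) × π ∈ᴾ map (insert zero k) (permutations n))
  disjoint {i} {k} i≢k {π} (π∈ᵢ , π∈ₖ) = i≢k (trans
    (sym (map-at-zero (insert zero i) (λ _ → refl) {π} (permutations n) π∈ᵢ))
    (map-at-zero (insert zero k) (λ _ → refl) {π} (permutations n) π∈ₖ))

length-permutations : ∀ n → length (permutations n) ≡ n !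
length-permutations zero    = refl
length-permutations (suc n) = trans (go (allFin (suc n))) (cong₂ ℕ._*_ (Listₚ.length-tabulate (λ (i : Fin (suc n)) → i)) (length-permutations n))
  where
  go : ∀ is → length (concatMap (λ i → map (insert zero i) (permutations n)) is) ≡ length is ℕ.* length (permutations n)
  go []       = refl
  go (i ∷ is) = trans (Listₚ.length-++ (map (insert zero i) (permutations n)))
    (cong₂ ℕ._+_ (Listₚ.length-map (insert zero i) (permutations n)) (go is))

-- Both sides enumerate the permutations that send 0 to i.
∑-coset : ∀ {n} i (P Q : Permutation′ (suc n)) → P ⟨$⟩ʳ zero ≡ i → Q ⟨$⟩ʳ zero ≡ zero →
  ∀ F → (∀ {π ρ} → π Perm.≈ ρ → F π ≈ F ρ) →
  ∑ (map (insert zero i) (permutations n)) F ≈ ∑ (permutations n) (λ ρ → F (P ↔-∘ (lift₀ ρ ↔-∘ Q)))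
∑-coset {n} i P Q P0 Q0 F F-cong = ≈-trans
  (∑-set (permSetoid (suc n))
    (SetoidUniqueₚ.map⁺ (permSetoid n) (permSetoid (suc n)) (λ {π} {ρ} → insert-injective i {π} {ρ}) (permutations-unique n))
    (SetoidUniqueₚ.map⁺ (permSetoid n) (permSetoid (suc n)) (λ {π} {ρ} → g-injective {π} {ρ}) (permutations-unique n))
    (λ {π} π∈ → ∈-g {π} (map-at-zero (insert zero i) (λ _ → refl) {π} (permutations n) π∈))
    (λ {π} π∈ → ∈-insert {π} (map-at-zero g g-zero {π} (permutations n) π∈))
    F (λ {π} {ρ} → F-cong {π} {ρ}))
  (≈-reflexive (∑-map g (permutations n) F))
  where
  g : Permutation′ n → Permutation′ (suc n)
  g ρ = P ↔-∘ (lift₀ ρ ↔-∘ Q)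

  g-zero : ∀ ρ → g ρ ⟨$⟩ʳ zero ≡ i
  g-zero ρ = trans (cong (λ k → P ⟨$⟩ʳ (lift₀ ρ ⟨$⟩ʳ k)) Q0) P0

  g-cong : ∀ {π ρ} → π Perm.≈ ρ → g π Perm.≈ g ρ
  g-cong {π} {ρ} e k = cong (P ⟨$⟩ʳ_) (Perm.lift₀-cong π ρ e (Q ⟨$⟩ʳ k))

  g-injective : ∀ {π ρ} → g π Perm.≈ g ρ → π Perm.≈ ρ
  g-injective {π} {ρ} e k = Finₚ.suc-injective
    (subst (λ l → lift₀ π ⟨$⟩ʳ l ≡ lift₀ ρ ⟨$⟩ʳ l) (Perm.inverseʳ Q) (perm-injective P (e (Q ⟨$⟩ˡ suc k))))

  ∈-map : ∀ (h : Permutation′ n → Permutation′ (suc n)) → (∀ {π ρ} → π Perm.≈ ρ → h π Perm.≈ h ρ) →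
          ∀ {π} ρ → π Perm.≈ h ρ → π ∈ᴾ map h (permutations n)
  ∈-map h h-cong {π} ρ e with permutations-complete n ρ
  ... | σ , σ∈ , ρ≈σ = Any.map (λ { refl k → trans (e k) (h-cong {ρ} {σ} ρ≈σ k) }) (Memₚ.∈-map⁺ h σ∈)

  ∈-insert : ∀ {π} → π ⟨$⟩ʳ zero ≡ i → π ∈ᴾ map (insert zero i) (permutations n)
  ∈-insert {π} refl = ∈-map (insert zero i) (λ {π} {ρ} → insert-cong i {π} {ρ}) {π} (remove zero π)
    (λ k → sym (Perm.insert-remove zero π k))

  ∈-g : ∀ {π} → π ⟨$⟩ʳ zero ≡ i → π ∈ᴾ map g (permutations n)
  ∈-g {π} π0 = ∈-map g (λ {π} {ρ} → g-cong {π} {ρ}) {π} (remove zero σ) λ k → begin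
    π ⟨$⟩ʳ k                                                     ≡⟨ cong (π ⟨$⟩ʳ_) (Perm.inverseˡ Q) ⟨
    π ⟨$⟩ʳ (Q ⟨$⟩ˡ (Q ⟨$⟩ʳ k))                                   ≡⟨ Perm.inverseʳ P ⟨
    P ⟨$⟩ʳ (σ ⟨$⟩ʳ (Q ⟨$⟩ʳ k))                                   ≡⟨ cong (P ⟨$⟩ʳ_) (Perm.lift₀-remove σ σ0 (Q ⟨$⟩ʳ k)) ⟨
    P ⟨$⟩ʳ (lift₀ (remove zero σ) ⟨$⟩ʳ (Q ⟨$⟩ʳ k))               ∎
    where
    open ≡-Reasoning
    -- The equation `π = P ∘ lift₀ ρ ∘ Q` solved for its middle factor, which fixes 0 and is
    -- therefore a lift.
    σ : Permutation′ (suc n)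
    σ = Perm.flip P ↔-∘ (π ↔-∘ Perm.flip Q)

    σ0 : σ ⟨$⟩ʳ zero ≡ zero
    σ0 = begin
      P ⟨$⟩ˡ (π ⟨$⟩ʳ (Q ⟨$⟩ˡ zero))              ≡⟨ cong (λ k → P ⟨$⟩ˡ (π ⟨$⟩ʳ (Q ⟨$⟩ˡ k))) Q0 ⟨
      P ⟨$⟩ˡ (π ⟨$⟩ʳ (Q ⟨$⟩ˡ (Q ⟨$⟩ʳ zero)))     ≡⟨ cong (λ k → P ⟨$⟩ˡ (π ⟨$⟩ʳ k)) (Perm.inverseˡ Q) ⟩
      P ⟨$⟩ˡ (π ⟨$⟩ʳ zero)                       ≡⟨ cong (P ⟨$⟩ˡ_) (trans π0 (sym P0)) ⟩
      P ⟨$⟩ˡ (P ⟨$⟩ʳ zero)                       ≡⟨ Perm.inverseˡ P ⟩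
      zero                                       ∎

-- Invariance under all conjugations would not survive the recursion: the cycle type of `swap₀₁ ρ`
-- depends on which cycle of `ρ` contains 0. Restricting to conjugators that fix 0 repairs this. The
-- case `γ = Perm.id` says that `F` respects pointwise equality.
ConjugationInvariant₀ : ∀ {n} → (Permutation′ (suc n) → Poly) → Set
ConjugationInvariant₀ F = ∀ α β γ → γ ⟨$⟩ʳ zero ≡ zero →
  (∀ x → γ ⟨$⟩ʳ (α ⟨$⟩ʳ x) ≡ β ⟨$⟩ʳ (γ ⟨$⟩ʳ x)) → F α ≈ F β

swap₀₁ : ∀ {n} → Permutation′ (suc n) → Permutation′ (suc (suc n))
swap₀₁ ρ = transpose zero (suc zero) ↔-∘ lift₀ ρ

-- The new point 0 either is fixed (lift₀) or is put in front of the old point 0 in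
-- its cycle (swap₀₁); the coefficient counts the permutations accounted for.
leaves : ∀ n → List (ℕ × Permutation′ (suc n))
leaves zero    = (1 , Perm.id) ∷ []
leaves (suc n) = map (map₂ lift₀) (leaves n) ++ map (λ (c , ρ) → suc n ℕ.* c , swap₀₁ ρ) (leaves n)

module _ {n} (F : Permutation′ (suc (suc n)) → Poly) (F-conj : ConjugationInvariant₀ F) where

  F-cong : ∀ {π ρ} → π Perm.≈ ρ → F π ≈ F ρ
  F-cong {π} {ρ} e = F-conj π ρ Perm.id refl e

  ∑-split : ∑ (permutations (suc (suc n))) F
          ≈ ∑ (permutations (suc n)) (F ∘ lift₀) + suc n · ∑ (permutations (suc n)) (F ∘ swap₀₁)
  ∑-split = begin
    ∑ (permutations (suc (suc n))) F                             ≈⟨ ∑-concatMap block (allFin (suc (suc n))) F ⟩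
    ∑ (block zero) F + ∑ (tabulate suc) (λ i → ∑ (block i) F)    ≈⟨ ⊕-cong fixing (∑-const (tabulate suc) (λ i → ∑ (block i) F) swapped (Allₚ.tabulate⁺ coset)) ⟩
    lifted + length (tabulate {n = suc n} suc) · swapped         ≡⟨ cong (λ m → lifted + m · swapped) (Listₚ.length-tabulate {n = suc n} (suc {suc n})) ⟩
    lifted + suc n · swapped                                     ∎
    where
    open ≈-Reasoning
    lifted swapped : Poly
    lifted  = ∑ (permutations (suc n)) (F ∘ lift₀)
    swapped = ∑ (permutations (suc n)) (F ∘ swap₀₁)

    block : Fin (suc (suc n)) → List (Permutation′ (suc (suc n)))
    block i = map (insert zero i) (permutations (suc n))

    fixing : ∑ (block zero) F ≈ lifted
    fixing = ≈-trans
      (∑-coset zero Perm.id Perm.id refl refl F (λ {π} {ρ} → F-cong {π} {ρ}))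
      (∑-cong (permutations (suc n)) λ ρ → F-cong {Perm.id ↔-∘ (lift₀ ρ ↔-∘ Perm.id)} {lift₀ ρ} λ _ → refl)

    coset : ∀ i → ∑ (block (suc i)) F ≈ swapped
    coset i = ≈-trans
      -- `γ` fixes 0 and moves 1 to `suc i`, so the block of `suc i` consists, up to order, of the
      -- conjugates by `γ` of the permutations `swap₀₁ ρ`.
      (∑-coset (suc i) (γ ↔-∘ transpose zero (suc zero)) (Perm.flip γ) refl refl F (λ {π} {ρ} → F-cong {π} {ρ}))
      (∑-cong (permutations (suc n)) λ ρ →
        F-conj ((γ ↔-∘ transpose zero (suc zero)) ↔-∘ (lift₀ ρ ↔-∘ Perm.flip γ)) (swap₀₁ ρ) (Perm.flip γ) refl
          (λ _ → Perm.inverseˡ γ))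
      where
      γ : Permutation′ (suc (suc n))
      γ = lift₀ (transpose zero i)

∑-leaves : ∀ n (F : Permutation′ (suc n) → Poly) → ConjugationInvariant₀ F →
           ∑ (permutations (suc n)) F ≈ ∑ (leaves n) (λ (c , π) → c · F π)
-- The only permutation of one point is enumerated as an insertion, which agrees with `Perm.id` only
-- pointwise.
∑-leaves zero    F F-conj = +-congʳ (≈-trans (F-conj (insert zero zero Perm.id) Perm.id Perm.id refl λ { zero → refl }) (≈-sym (+-identityʳ _)))
∑-leaves (suc n) F F-conj = begin
  ∑ (permutations (suc (suc n))) F
    ≈⟨ ∑-split F F-conj ⟩
  ∑ (permutations (suc n)) (F ∘ lift₀) + suc n · ∑ (permutations (suc n)) (F ∘ swap₀₁)
    ≈⟨ ⊕-cong (∑-leaves n (F ∘ lift₀) lift-conj) (×-congʳ (suc n) (∑-leaves n (F ∘ swap₀₁) swap-conj)) ⟩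
  ∑ (leaves n) (λ (c , ρ) → c · F (lift₀ ρ)) + suc n · ∑ (leaves n) (λ (c , ρ) → c · F (swap₀₁ ρ))
    ≈⟨ +-congˡ (≈-trans (∑-· (suc n) (leaves n) _) (∑-cong (leaves n) λ (c , ρ) → ×-assocˡ (F (swap₀₁ ρ)) (suc n) c)) ⟩
  ∑ (leaves n) (λ (c , ρ) → c · F (lift₀ ρ)) + ∑ (leaves n) (λ (c , ρ) → (suc n ℕ.* c) · F (swap₀₁ ρ))
    ≡⟨ cong₂ _+_ (∑-map (map₂ lift₀) (leaves n) _) (∑-map (λ (c , ρ) → suc n ℕ.* c , swap₀₁ ρ) (leaves n) _) ⟨
  ∑ (map (map₂ lift₀) (leaves n)) (λ (c , π) → c · F π) + ∑ (map (λ (c , ρ) → suc n ℕ.* c , swap₀₁ ρ) (leaves n)) (λ (c , π) → c · F π)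
    ≈⟨ ∑-++ (map (map₂ lift₀) (leaves n)) _ _ ⟨
  ∑ (leaves (suc n)) (λ (c , π) → c · F π) ∎
  where
  open ≈-Reasoning
  lift-conj : ConjugationInvariant₀ (F ∘ lift₀)
  lift-conj α β γ _ e = F-conj (lift₀ α) (lift₀ β) (lift₀ γ) refl
    λ { zero → refl ; (suc x) → cong suc (e x) }

  swap-conj : ConjugationInvariant₀ (F ∘ swap₀₁)
  -- As `γ` fixes 0, its lift fixes both 0 and 1 and hence commutes with their transposition.
  swap-conj α β γ γ0 e = F-conj (swap₀₁ α) (swap₀₁ β) (lift₀ γ) refl
    λ { zero → cong suc γ0 ; (suc x) → trans (commutes (α ⟨$⟩ʳ x)) (cong (λ k → transpose zero (suc zero) ⟨$⟩ʳ suc k) (e x)) }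
    where
    γ-suc : ∀ k → γ ⟨$⟩ʳ suc k ≢ zero
    γ-suc k γk = contradiction (perm-injective γ (trans γk (sym γ0))) λ ()

    commutes : ∀ k → lift₀ γ ⟨$⟩ʳ (transpose zero (suc zero) ⟨$⟩ʳ suc k) ≡ transpose zero (suc zero) ⟨$⟩ʳ suc (γ ⟨$⟩ʳ k)
    commutes zero rewrite γ0 = refl
    commutes (suc k) with γ ⟨$⟩ʳ suc k | γ-suc k
    ... | zero  | ≢0 = contradiction refl ≢0
    ... | suc l | _  = refl

-- The action on r-element subsets

subsetOfSize : ∀ {n r} → r ≤ n → ∃ λ (S : Subset n) → ∣ S ∣ ≡ r
subsetOfSize {n} z≤n     = Subset.⊥ , Subsetₚ.∣⊥∣≡0 n
subsetOfSize (s≤s r≤n) with subsetOfSize r≤n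
... | S , e = inside ∷ S , cong suc e

-- Of the `n + 2` points, a standard set contains 0, omits 1 and takes `r` of the others. It is
-- moved by a permutation that sends 0 to `i` and 1 to `k`.
separatingSubset : ∀ {n r} → r ≤ n → ∀ {i k : Fin (suc (suc n))} → i ≢ k →
  ∃ λ (S : Subset (suc (suc n))) → ∣ S ∣ ≡ suc r × lookup S i ≡ inside × lookup S k ≡ outside
separatingSubset {n} {r} r≤n {i} {k} i≢k with subsetOfSize r≤n
... | T , e = image γ S , trans (∣image∣ γ S) (cong suc e) , at zero , trans (cong (lookup (image γ S)) k≡) (at (suc zero))
  where
  S : Subset (suc (suc n))
  S = inside ∷ outside ∷ T

  γ : Permutation′ (suc (suc n))
  γ = insert zero i (transpose zero (punchOut i≢k))

  k≡ : k ≡ γ ⟨$⟩ʳ suc zero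
  k≡ = sym (Finₚ.punchIn-punchOut i≢k)

  at : ∀ l → lookup (image γ S) (γ ⟨$⟩ʳ l) ≡ lookup S l
  at l = trans (lookup-image γ S (γ ⟨$⟩ʳ l)) (cong (lookup S) (Perm.inverseˡ γ {l}))

-- If the inverses differed at `i`, a subset containing one of the two preimages of `i` but not the
-- other would have images that differ at `i`.
induced-faithful : ∀ {n r} → r ≤ n → (α β : Permutation′ (suc (suc n))) →
  (∀ S → Inverse.to (induced (suc r) α) S ≡ Inverse.to (induced (suc r) β) S) → α Perm.≈ β
induced-faithful r≤n α β α≈β x = trans (cong (α ⟨$⟩ʳ_) (trans (sym (Perm.inverseˡ β)) (sym (inverses (β ⟨$⟩ʳ x)))))
  (Perm.inverseʳ α)
  where
  inverses : ∀ i → α ⟨$⟩ˡ i ≡ β ⟨$⟩ˡ i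
  inverses i = decidable-stable (α ⟨$⟩ˡ i Finₚ.≟ β ⟨$⟩ˡ i) λ ≢ →
    let S , |S| , in-S , out-S = separatingSubset r≤n ≢
        inside≡outside = begin
          inside                      ≡⟨ in-S ⟨
          lookup S (α ⟨$⟩ˡ i)         ≡⟨ lookup-image α S i ⟨
          lookup (image α S) i        ≡⟨ cong (λ T → lookup (value T) i) (α≈β (S , [ |S| ])) ⟩
          lookup (image β S) i        ≡⟨ lookup-image β S i ⟩
          lookup S (β ⟨$⟩ˡ i)         ≡⟨ out-S ⟩
          outside                     ∎
    in contradiction inside≡outside λ ()
    where open ≡-Reasoning

induced-conj : ∀ {p} r (α β γ : Permutation′ p) → (∀ x → γ ⟨$⟩ʳ (α ⟨$⟩ʳ x) ≡ β ⟨$⟩ʳ (γ ⟨$⟩ʳ x)) →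
  ∀ S → Inverse.to (induced r γ) (Inverse.to (induced r α) S) ≡ Inverse.to (induced r β) (Inverse.to (induced r γ) S)
induced-conj r α β γ γα≗βγ S = value-injective (begin
  image γ (image α (value S))   ≡⟨ image-∘ γ α (value S) ⟨
  image (γ ↔-∘ α) (value S)     ≡⟨ image-cong (γ ↔-∘ α) (β ↔-∘ γ) γα≗βγ (value S) ⟩
  image (β ↔-∘ γ) (value S)     ≡⟨ image-∘ β γ (value S) ⟩
  image β (image γ (value S))   ∎)
  where open ≡-Reasoning

deduplicate-id : ∀ {R : Rel A 0ℓ} (R? : Decidable R) {xs} → AllPairs (λ x y → ¬ R x y) xs → deduplicate R? xs ≡ xs
deduplicate-id R? []           = refl
deduplicate-id R? (x∉xs ∷ xs!) = cong (_ ∷_)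
  (trans (cong (List.filter _) (deduplicate-id R? xs!)) (Listₚ.filter-all _ x∉xs))

-- By faithfulness, the deduplication in `rGroup` removes nothing; the cycle index thus becomes a
-- sum over the whole symmetric group, and the order is a factorial.
members-rGroup : ∀ {n r} → r ≤ n → PermutationGroup.members (rGroup (suc (suc n)) (suc r))
                                 ≡ map (induced (suc r)) (permutations (suc (suc n)))
members-rGroup {n} {r} r≤n = deduplicate-id (DecSetoid._≟_ (permDecSetoid (rSubsetsOf (suc (suc n)) (suc r))))
  (AllPairsₚ.map⁺ (AllPairs.map (λ {α} {β} α≉β α≈β → α≉β (induced-faithful r≤n α β α≈β)) (permutations-unique (suc (suc n)))))

-- Monomials

∏-cong : ∀ (xs : List A) {f g : A → Poly} → (∀ x → f x ≈ g x) → ∏ xs f ≈ ∏ xs g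
∏-cong []       e = ≈-refl
∏-cong (x ∷ xs) e = ⊗-cong (e x) (∏-cong xs e)

Monomial Term : Set
Monomial = List (ℕ × ℕ)
Term     = ℕ × Monomial

monomial : Monomial → Poly
monomial m = ∏ m (λ (k , e) → a k ^ e)

term : Term → Poly
term (c , m) = c · monomial m

-- An entry `k` of the first list stands for cycle length `suc k`. Zero exponents are dropped, so
-- that equal monomials become equal lists and like terms can be recognised.
exponents : List ℕ → List ℕ → Monomial
exponents []       ns = []
exponents (k ∷ ks) ns with multiplicity (suc k) ns ℕ./ suc k
... | zero      = exponents ks ns
... | e@(suc _) = (suc k , e) ∷ exponents ks ns

∏-exponents : ∀ ks ns → ∏ ks (λ k → a (suc k) ^ (multiplicity (suc k) ns ℕ./ suc k)) ≈ monomial (exponents ks ns)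
∏-exponents []       ns = ≈-refl
∏-exponents (k ∷ ks) ns with multiplicity (suc k) ns ℕ./ suc k
... | zero  = ≈-trans (*-identityˡ _) (∏-exponents ks ns)
... | suc e = *-congˡ (∏-exponents ks ns)

-- Cycle monomials of induced permutations

cycleMonomial : (X : FiniteSet) → Bijection X → Poly
cycleMonomial X α = ∏ (map suc (upTo (FiniteSet.degree X))) (λ k → a k ^ j X α k)

cycleMonomial-cong : ∀ X (α : Bijection X) (e : ℕ → ℕ) → (∀ k → j X α (suc k) ≡ e k) →
  cycleMonomial X α ≈ ∏ (upTo (FiniteSet.degree X)) (λ k → a (suc k) ^ e k)
cycleMonomial-cong X α e j≡e = ≈-trans
  (≈-reflexive (Listₚ.foldr-map _ suc (# 1) ks))
  (∏-cong ks λ k → ≈-reflexive (cong (a (suc k) ^_) (j≡e k)))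
  where ks = upTo (FiniteSet.degree X)

cycleMonomial-conj : ∀ p r → ConjugationInvariant₀ (cycleMonomial (rSubsetsOf (suc p) r) ∘ induced r)
cycleMonomial-conj p r α β γ _ γα≗βγ = ≈-trans
  (cycleMonomial-cong X (induced r α) (λ k → j X (induced r β) (suc k))
    (j-conj X (induced r α) (induced r β) (induced r γ) (induced-conj r α β γ γα≗βγ)))
  (≈-sym (cycleMonomial-cong X (induced r β) _ λ _ → refl))
  where X = rSubsetsOf (suc p) r

-- The inverse permutation is passed as a vector, so that it is evaluated only once.
imageCycleLengths : ∀ {p} → List (Subset p) → Vec (Fin p) p → List ℕ
imageCycleLengths Ss π⁻¹ = map (λ S → firstReturn (Vecₚ.≡-dec Boolₚ._≟_) step S (length Ss) (step S)) Ss
  where step = λ S → Vec.map (lookup S) π⁻¹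

-- `value` is injective and intertwines the induced permutation with `step`, so return times may be
-- computed on bare subsets, free of cardinality proofs.
cycleLengths-induced : ∀ p r (π : Permutation′ p) →
  cycleLengths (rSubsetsOf p r) (induced r π) ≡ imageCycleLengths (map value (rSubsets p r)) (Vec.tabulate (π ⟨$⟩ˡ_))
cycleLengths-induced p r π = begin
  map (λ S → length (cycle X α S)) (rSubsets p r)                                     ≡⟨ Listₚ.map-cong lengths (rSubsets p r) ⟩
  map (λ S → firstReturn _≟ᵛ_ step (value S) degree (step (value S))) (rSubsets p r)  ≡⟨ Listₚ.map-∘ (rSubsets p r) ⟩
  map (λ S → firstReturn _≟ᵛ_ step S degree (step S)) (map value (rSubsets p r))      ≡⟨ cong (λ n → map (λ S → firstReturn _≟ᵛ_ step S n (step S)) (map value (rSubsets p r)))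
                                                                                          (Listₚ.length-map value (rSubsets p r)) ⟨
  imageCycleLengths (map value (rSubsets p r)) (Vec.tabulate (π ⟨$⟩ˡ_))                   ∎
  where
  open ≡-Reasoning
  X = rSubsetsOf p r
  α = induced r π
  open FiniteSet X using (degree)

  _≟ᵛ_ : DecidableEquality (Subset p)
  _≟ᵛ_ = Vecₚ.≡-dec Boolₚ._≟_

  step : Subset p → Subset p
  step S = Vec.map (lookup S) (Vec.tabulate (π ⟨$⟩ˡ_))

  value-step : ∀ S → value (Inverse.to α S) ≡ step (value S)
  value-step S = Vecₚ.tabulate-∘ (lookup (value S)) (π ⟨$⟩ˡ_)

  lengths : ∀ S → length (cycle X α S) ≡ firstReturn _≟ᵛ_ step (value S) degree (step (value S))
  lengths S = trans (length-cycle X α S) (trans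
    (firstReturn-map (FiniteSet._≟_ X) _≟ᵛ_ value value-injective value-step S degree (Inverse.to α S))
    (cong (firstReturn _≟ᵛ_ step (value S) degree) (value-step S)))

leafTerm : ∀ {p} → List (Subset p) → ℕ × Permutation′ p → Term
leafTerm Ss (c , π) = c , exponents (upTo (length Ss)) (imageCycleLengths Ss (Vec.tabulate (π ⟨$⟩ˡ_)))

cycleMonomial-leaf : ∀ p r c (π : Permutation′ p) →
  c · cycleMonomial (rSubsetsOf p r) (induced r π) ≈ term (leafTerm (map value (rSubsets p r)) (c , π))
cycleMonomial-leaf p r c π = ×-congʳ c (begin
  cycleMonomial X (induced r π)
    ≈⟨ cycleMonomial-cong X (induced r π) _ (j-/ X (induced r π)) ⟩
  ∏ (upTo degree) (λ k → a (suc k) ^ (multiplicity (suc k) (cycleLengths X (induced r π)) ℕ./ suc k))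
    ≈⟨ ∏-exponents (upTo degree) (cycleLengths X (induced r π)) ⟩
  monomial (exponents (upTo degree) (cycleLengths X (induced r π)))
    ≡⟨ cong₂ (λ n ns → monomial (exponents (upTo n) ns)) (sym (Listₚ.length-map value (rSubsets p r))) (cycleLengths-induced p r π) ⟩
  monomial (exponents (upTo (length (map value (rSubsets p r)))) (imageCycleLengths (map value (rSubsets p r)) (Vec.tabulate (π ⟨$⟩ˡ_))))
    ∎)
  where
  open ≈-Reasoning
  X = rSubsetsOf p r
  open FiniteSet X using (degree)

leafTerms : ∀ n r → List Term
leafTerms n r = map (leafTerm (map value (rSubsets (suc n) r))) (leaves n)

cycleIndex-rGroup : ∀ {n r} → r ≤ n →
  cycleIndex (rSubsetsOf (suc (suc n)) (suc r)) (rGroup (suc (suc n)) (suc r))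
  ≈ const (_/_ (+ 1) (suc (suc n) !) {{ ℕₚ._!≢0 (suc (suc n)) }}) * ∑ (leafTerms (suc n) (suc r)) term
cycleIndex-rGroup {n} {r} r≤n = ⊗-cong
  (≈-reflexive (cong const (ℚₚ./-cong {+ 1} {order} {+ 1} {p !} {{order-nonZero}} {{ ℕₚ._!≢0 p }} refl order≡)))
  (begin
    ∑ (PermutationGroup.members (rGroup p (suc r))) (cycleMonomial X)    ≡⟨ cong (λ αs → ∑ αs (cycleMonomial X)) (members-rGroup r≤n) ⟩
    ∑ (map (induced (suc r)) (permutations p)) (cycleMonomial X)         ≡⟨ ∑-map (induced (suc r)) (permutations p) (cycleMonomial X) ⟩
    ∑ (permutations p) (cycleMonomial X ∘ induced (suc r))               ≈⟨ ∑-leaves (suc n) (cycleMonomial X ∘ induced (suc r)) (cycleMonomial-conj (suc n) (suc r)) ⟩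
    ∑ (leaves (suc n)) (λ (c , π) → c · cycleMonomial X (induced (suc r) π)) ≈⟨ ∑-cong (leaves (suc n)) (λ (c , π) → cycleMonomial-leaf p (suc r) c π) ⟩
    ∑ (leaves (suc n)) (term ∘ leafTerm (map value (rSubsets p (suc r))))    ≡⟨ ∑-map (leafTerm (map value (rSubsets p (suc r)))) (leaves (suc n)) term ⟨
    ∑ (leafTerms (suc n) (suc r)) term                                   ∎)
  where
  open ≈-Reasoning
  p = suc (suc n)
  X = rSubsetsOf p (suc r)

  open PermutationGroup (rGroup p (suc r)) using (order; order-nonZero)

  order≡ : order ≡ p !
  order≡ = trans (cong length (members-rGroup r≤n))
    (trans (Listₚ.length-map (induced (suc r)) (permutations p)) (length-permutations p))

-- Collecting like terms

_≟ᵐ_ : DecidableEquality Monomial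
_≟ᵐ_ = Listₚ.≡-dec (×ₚ.≡-dec ℕₚ._≟_ ℕₚ._≟_)

_≟ᵗ_ : DecidableEquality (List Term)
_≟ᵗ_ = Listₚ.≡-dec (×ₚ.≡-dec ℕₚ._≟_ _≟ᵐ_)

addTerm : Term → List Term → List Term
addTerm t       []             = t ∷ []
addTerm (c , m) ((d , n) ∷ ts) with m ≟ᵐ n
... | yes _ = (c ℕ.+ d , n) ∷ ts
... | no  _ = (d , n) ∷ addTerm (c , m) ts

-- The monomials in ms come first in the result, in the order given.
collect : List Monomial → List Term → List Term
collect ms = foldr addTerm (map (0 ,_) ms)

∑-addTerm : ∀ t ts → ∑ (addTerm t ts) term ≈ term t + ∑ ts term
∑-addTerm t       []             = ≈-refl
∑-addTerm (c , m) ((d , n) ∷ ts) with m ≟ᵐ n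
... | yes refl = ≈-trans (+-congʳ (×-homo-+ (monomial m) c d)) (+-assoc _ _ _)
... | no  _    = begin
  term (d , n) + ∑ (addTerm (c , m) ts) term        ≈⟨ +-congˡ (∑-addTerm (c , m) ts) ⟩
  term (d , n) + (term (c , m) + ∑ ts term)         ≈⟨ +-assoc _ _ _ ⟨
  term (d , n) + term (c , m) + ∑ ts term           ≈⟨ +-congʳ (+-comm _ _) ⟩
  term (c , m) + term (d , n) + ∑ ts term           ≈⟨ +-assoc _ _ _ ⟩
  term (c , m) + (term (d , n) + ∑ ts term)         ∎
  where
  open ≈-Reasoning

∑-collect : ∀ ms ts → ∑ (collect ms ts) term ≈ ∑ ts term
∑-collect []       []       = ≈-refl
-- A seed has coefficient 0 and contributes nothing.
∑-collect (m ∷ ms) []       = ≈-trans (+-identityˡ _) (∑-collect ms [])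
∑-collect ms       (t ∷ ts) = ≈-trans (∑-addTerm t (collect ms ts)) (+-congˡ (∑-collect ms ts))

-- Sums of terms in conventional notation

-- For a variable `n` the fraction `+ n / 1` is stuck on its reduction to lowest terms; coprimality
-- with 1 replaces it by an explicit `mkℚ`, on which addition computes.
1+n/1 : ∀ n → + 1 / 1 ℚ.+ + n / 1 ≡ + suc n / 1
1+n/1 n = begin
  + 1 / 1 ℚ.+ + n / 1                             ≡⟨ cong (+ 1 / 1 ℚ.+_) (ℚₚ.normalize-coprime n-coprime-1) ⟩
  + 1 / 1 ℚ.+ mkℚ (+ n) 0 n-coprime-1             ≡⟨ cong (λ z → (+ 1 ℤ.+ z) / 1) (ℤₚ.*-identityʳ (+ n)) ⟩
  + suc n / 1                                     ∎
  where
  open ≡-Reasoning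
  n-coprime-1 : Coprimality.Coprime n 1
  n-coprime-1 = Coprimality.sym (Coprimality.1-coprimeTo n)

·≈#* : ∀ n p → n · p ≈ # n * p
·≈#* zero    p = ≈-sym (zeroˡ p)
·≈#* (suc n) p = begin
  p + n · p                  ≈⟨ ⊕-cong (≈-sym (*-identityˡ p)) (·≈#* n p) ⟩
  # 1 * p + # n * p          ≈⟨ distribʳ p (# 1) (# n) ⟨
  (# 1 + # n) * p            ≈⟨ *-congʳ (≈-trans (Polynomial.const-+ (+ 1 / 1) (+ n / 1)) (≈-reflexive (cong const (1+n/1 n)))) ⟩
  # (suc n) * p              ∎
  where open ≈-Reasoning

-- Together with `powers`, `summand` and `summands` this imitates written notation: sums and
-- products nest to the left, exponents 1 are omitted, and so are coefficients 1 before a nonempty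
-- monomial. The polynomial displayed in the theorem is then definitionally of the form
-- `summands (summand t) ts`.
power : ℕ × ℕ → Poly
power (k , 1) = a k
power (k , e) = a k ^ e

power≈ : ∀ k e → power (k , e) ≈ a k ^ e
power≈ k 0             = ≈-refl
power≈ k 1             = ≈-sym (*-identityʳ (a k))
power≈ k (suc (suc e)) = ≈-refl

powers : Poly → Monomial → Poly
powers = foldl (λ p x → p * power x)

powers≈ : ∀ p m → powers p m ≈ p * monomial m
powers≈ p []            = ≈-sym (*-identityʳ p)
powers≈ p ((k , e) ∷ m) = ≈-trans (powers≈ (p * power (k , e)) m)
  (≈-trans (*-congʳ (*-congˡ (power≈ k e))) (*-assoc p (a k ^ e) (monomial m)))

summand : Term → Poly
summand (1 , x ∷ m) = powers (power x) m
summand (c , m)     = powers (# c) m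

summand≈ : ∀ t → summand t ≈ term t
summand≈ (1 , (k , e) ∷ m)  = ≈-trans (powers≈ (power (k , e)) m) (≈-trans (*-congʳ (power≈ k e)) (≈-sym (+-identityʳ _)))
summand≈ (1 , [])           = ≈-sym (+-identityʳ _)
summand≈ (0 , m)            = ≈-trans (powers≈ (# 0) m) (≈-sym (·≈#* 0 (monomial m)))
summand≈ (suc (suc c) , m)  = ≈-trans (powers≈ (# (suc (suc c))) m) (≈-sym (·≈#* (suc (suc c)) (monomial m)))

summands : Poly → List Term → Poly
summands = foldl (λ p t → p + summand t)

summands≈ : ∀ p ts → summands p ts ≈ p + ∑ ts term
summands≈ p []       = ≈-sym (+-identityʳ p)
summands≈ p (t ∷ ts) = ≈-trans (summands≈ (p + summand t) ts)
  (≈-trans (+-congʳ (+-congˡ (summand≈ t))) (+-assoc p (term t) (∑ ts term)))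

-- Leaves a single hypothesis to be checked by evaluation, the equality of the collected leaf terms
-- with the expected list; `ms` prescribes the order of the terms.
cycleIndex-collected : ∀ {p r} → 0 < r → r < p →
  ∀ ms t ts → collect ms (leafTerms (ℕ.pred p) r) ≡ t ∷ ts →
  cycleIndex (rSubsetsOf p r) (rGroup p r) ≈ const (_/_ (+ 1) (p !) {{ ℕₚ._!≢0 p }}) * summands (summand t) ts
cycleIndex-collected {suc (suc n)} {suc r} (s≤s z≤n) (s≤s (s≤s r≤n)) ms t ts collected =
  ≈-trans (cycleIndex-rGroup r≤n) (*-congˡ (begin
  ∑ (leafTerms (suc n) (suc r)) term               ≈⟨ ∑-collect ms (leafTerms (suc n) (suc r)) ⟨
  ∑ (collect ms (leafTerms (suc n) (suc r))) term  ≡⟨ cong (λ ts → ∑ ts term) collected ⟩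
  term t + ∑ ts term                               ≈⟨ +-congʳ (summand≈ t) ⟨
  summand t + ∑ ts term                            ≈⟨ summands≈ (summand t) ts ⟨
  summands (summand t) ts                          ∎))
  where open ≈-Reasoning

-- The terms for the 3-subsets of 8 points

first : Term
first = 1 , (1 , 56) ∷ []

rest : List Term
rest =
    (28 , (1 , 26) ∷ (2 , 15) ∷ [])
  ∷ (210 , (1 , 12) ∷ (2 , 22) ∷ [])
  ∷ (112 , (1 , 11) ∷ (3 , 15) ∷ [])
  ∷ (420 , (1 , 6) ∷ (2 , 25) ∷ [])
  ∷ (1120 , (1 , 5) ∷ (2 , 3) ∷ (3 , 7) ∷ (6 , 4) ∷ [])
  ∷ (420 , (1 , 4) ∷ (2 , 4) ∷ (4 , 11) ∷ [])
  ∷ (1680 , (1 , 3) ∷ (2 , 4) ∷ (3 , 3) ∷ (6 , 6) ∷ [])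
  ∷ (2520 , (1 , 2) ∷ (2 , 5) ∷ (4 , 11) ∷ [])
  ∷ (1120 , (1 , 2) ∷ (3 , 18) ∷ [])
  ∷ (1120 , (1 , 2) ∷ (3 , 8) ∷ (6 , 5) ∷ [])
  ∷ (4032 , (1 , 1) ∷ (5 , 5) ∷ (10 , 3) ∷ [])
  ∷ (3360 , (1 , 1) ∷ (2 , 1) ∷ (3 , 1) ∷ (4 , 2) ∷ (6 , 1) ∷ (12 , 3) ∷ [])
  ∷ (2688 , (1 , 1) ∷ (5 , 2) ∷ (15 , 3) ∷ [])
  ∷ (1344 , (1 , 1) ∷ (5 , 11) ∷ [])
  ∷ (105 , (2 , 28) ∷ [])
  ∷ (1260 , (2 , 6) ∷ (4 , 11) ∷ [])
  ∷ (3360 , (2 , 1) ∷ (3 , 2) ∷ (6 , 8) ∷ [])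
  ∷ (3360 , (2 , 1) ∷ (6 , 9) ∷ [])
  ∷ (1260 , (4 , 14) ∷ [])
  ∷ (5760 , (7 , 8) ∷ [])
  ∷ (5040 , (8 , 7) ∷ [])
  ∷ []

monomials : List Monomial
monomials = map (λ (c , m) → m) (first ∷ rest)

-- With ℕ.pred 8 instead of 7 the type is syntactically an instance of the
-- hypothesis of cycleIndex-collected; Agda would otherwise normalise both.
collected : collect monomials (leafTerms (ℕ.pred 8) 3) ≡ first ∷ rest
collected = toWitness {a? = collect monomials (leafTerms (ℕ.pred 8) 3) ≟ᵗ (first ∷ rest)} _

mainTheorem4 : cycleIndex (rSubsetsOf 8 3) (rGroup 8 3) ≈
    const (+ 1 / 8 !) *
    ( a 1 ^ 56
    + # 28 * a 1 ^ 26 * a 2 ^ 15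
    + # 210 * a 1 ^ 12 * a 2 ^ 22
    + # 112 * a 1 ^ 11 * a 3 ^ 15
    + # 420 * a 1 ^ 6 * a 2 ^ 25
    + # 1120 * a 1 ^ 5 * a 2 ^ 3 * a 3 ^ 7 * a 6 ^ 4
    + # 420 * a 1 ^ 4 * a 2 ^ 4 * a 4 ^ 11
    + # 1680 * a 1 ^ 3 * a 2 ^ 4 * a 3 ^ 3 * a 6 ^ 6
    + # 2520 * a 1 ^ 2 * a 2 ^ 5 * a 4 ^ 11
    + # 1120 * a 1 ^ 2 * a 3 ^ 18
    + # 1120 * a 1 ^ 2 * a 3 ^ 8 * a 6 ^ 5
    + # 4032 * a 1 * a 5 ^ 5 * a 10 ^ 3
    + # 3360 * a 1 * a 2 * a 3 * a 4 ^ 2 * a 6 * a 12 ^ 3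
    + # 2688 * a 1 * a 5 ^ 2 * a 15 ^ 3
    + # 1344 * a 1 * a 5 ^ 11
    + # 105 * a 2 ^ 28
    + # 1260 * a 2 ^ 6 * a 4 ^ 11
    + # 3360 * a 2 * a 3 ^ 2 * a 6 ^ 8
    + # 3360 * a 2 * a 6 ^ 9
    + # 1260 * a 4 ^ 14
    + # 5760 * a 7 ^ 8
    + # 5040 * a 8 ^ 7
    )
-- Left implicit, 8 and 3 would be sought by unfolding the cycle index.
mainTheorem4 =
  cycleIndex-collected {8} {3} (s≤s z≤n) (s≤s (s≤s (s≤s (s≤s z≤n)))) monomials first rest collected
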